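{- Let $G$ be a $d$-dimensional simplicial complex and let $(F,R)$ be a rooted forest of $G$. For any linear ordering $\alpha$ of $\overline{R}$ and any linear ordering $\beta$ of $F$, $$\sum_{\phi\text{ fitting orientation of }(F,R)}\Lambda_{\alpha,\beta}(\phi)=|H_{d-1}(F,R)|.$$ Moreover, for every fitting orientation $\phi$ of $(F,R)$, $\Lambda_{\alpha,\beta}(\phi)\in\{ -1,1\}$ does not depend on $(\alpha,\beta)$.
   Context: A simplicial complex on $n$ vertices is a nonempty collection $G$ of subsets of $[n]=\{1,\dots,n\}$ closed under taking subsets; its elements are called faces. A $k$-face is a face of cardinality $k+1$ (so $\emptyset$ is the $(-1)$-face), $G_k$ is the set of $k$-faces, and the dimension $d\ge 0$ of $G$ is the maximal dimension of its faces. Incidence matrix: for $k\ge 0$, $\partial_k^{G}$ is the matrix with rows indexed by $G_{k-1}$ and columns indexed by $G_k$ whose entry $\partial_k^{G}[r,f]$ is $(-1)^j$ if $f=\{v_0,\dots,v_k\}$ with $v_0<\cdots<v_k$ and $r=f\setminus\{v_j\}$, and $0$ if $r\not\subset f$. It is also viewed as the boundary map sending combinations of $k$-faces to combinations of $(k-1)$-faces. A subset $F\subseteq G_d$ is a forest of $G$ if the columns of $\partial_d^{G}$ indexed by $F$ are linearly independent (over $\mathbb{R}$). For $R\subseteq G_{d-1}$ write $\overline{R}=G_{d-1}\setminus R$. For a forest $F$, let $\partial_d^{F}$ be the submatrix of $\partial_d^{G}$ with columns indexed by $F$ and all rows indexed by $G_{d-1}$; $R$ is a root of $F$ if the rows of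 $\partial_d^{F}$ indexed by $\overline{R}$ form a basis of the row space of $\partial_d^{F}$. A rooted forest of $G$ is a pair $(F,R)$ where $F\subseteq G_d$ is a forest of $G$ (possibly empty) and $R\subseteq G_{d-1}$ is a root of $F$. In this case $|F|=|\overline{R}|$ and the submatrix $\partial_{\overline{R},F}$ of $\partial_d^{G}$ with rows $\overline{R}$ and columns $F$ has nonzero determinant. Relative homology: for $F\subseteq G_d$ and $R\subseteq G_{d-1}$, let $\Psi_{F,R}:\mathbb{Z}F\to \mathbb{Z}G_{d-1}/\mathbb{Z}R$ be the group homomorphism $x\mapsto \partial_d^{G}(x)+\mathbb{Z}R$, where $\mathbb{Z}S$ denotes the free abelian group on a set $S$. Then $H_{d-1}(F,R)=\operatorname{coker}\Psi_{F,R}=(\mathbb{Z}G_{d-1}/\mathbb{Z}R)/\operatorname{Im}(\Psi_{F,R})$, and $|H_{d-1}(F,R)|$ is its cardinality. A fitting orientation of a rooted forest $(F,R)$ is a bijection $\phi:\overline{R}\to F$ such that $r\subset\phi(r)$ for every $r\in\overline{R}$. Signs: let $m=|F|=|\overline{R}|$, let $\alpha$ be a linear ordering of $\overline{R}$ and $\beta$ a linear ordering of $F$. For a bijection $\phi:\overline{R}\to F$ let $\pi_{\alpha,\beta,\phi}\in S_m$ be the permutation such that $\phi$ maps the $i$th face of $\overline{R}$ (in the order $\alpha$) to the $\pi_{\alpha,\beta,\phi}(i)$th face of $F$ (in the order $\beta$). For a fitting orientation $\phi$ put $$\lambda_{\alpha,\beta}(\phi)=\operatorname{sign}(\pi_{\alpha,\beta,\phi})\prod_{r\in\overline{R}}\partial_d^{G}[r,\phi(r)].$$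 Let $\operatorname{sign}(\alpha,\beta)\in\{ -1,1\}$ be the sign of the determinant of the matrix obtained from $\partial_{\overline{R},F}$ by ordering its rows according to $\alpha$ and its columns according to $\beta$. The sign of $\phi$ is $\Lambda_{\alpha,\beta}(\phi)=\operatorname{sign}(\alpha,\beta)\cdot\lambda_{\alpha,\beta}(\phi)$. -}

module Defs where

open import Algebra.Bundles using (AbelianGroup; CommutativeMonoid; CommutativeRing)
import Algebra.Construct.Pointwise as Pointwise
open import Algebra.Morphism.Structures using (module GroupMorphisms)
import Algebra.Properties.AbelianGroup
import Algebra.Properties.CommutativeMonoid.Sum as Sum
open import Data.Bool.Base using (Bool; true; false; T; not; _∧_)
import Data.Bool.Properties as Bool
open import Data.Empty using (⊥; ⊥-elim)
open import Data.Fin.Base as Fin using (Fin; zero; suc; toℕ; punchIn)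
import Data.Fin.Properties as Fin
open import Data.Fin.Permutation using (Permutation′; _⟨$⟩ʳ_)
open import Data.Fin.Subset using (Subset; _∈_; _⊆_; _-_; ∣_∣)
open import Data.Fin.Subset.Properties using (_∈?_)
open import Data.Integer.Base using (ℤ; 0ℤ; 1ℤ; -1ℤ; +0; +[1+_]; -[1+_]; _^_)
  renaming (_+_ to _+ᶻ_; _*_ to _*ᶻ_; -_ to -ᶻ_)
import Data.Integer.Properties as ℤ
open import Data.Irrelevant using ([_])
open import Data.List.Base using (List; allFin; cartesianProduct; filter; length; lookup)
open import Data.Nat.Base as ℕ using (ℕ; zero; suc; _≤_)
import Data.Nat.Properties as ℕ
open import Data.Product.Base using (Σ; ∃-syntax; _×_; _,_; proj₁; proj₂)
open import Data.Rational.Base as ℚ using (ℚ; 0ℚ; 1ℚ; ½)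
import Data.Rational.Properties as ℚ
import Data.Rational.Solver as ℚ
open import Data.Refinement using (Refinement-syntax; _,_; value; proof)
open import Data.Sum.Base using (_⊎_; inj₁; inj₂)
open import Data.Sum.Function.Propositional using (_⊎-cong_)
open import Data.Unit.Base using (tt)
open import Data.Vec.Base using ([]; _∷_)
import Data.Vec.Properties as Vec
open import Function.Base using (_∘_)
open import Function.Bundles using (_↔_; Inverse; _⇔_; mk↔ₛ′)
open import Function.Properties.Inverse using (↔-refl; ↔-sym; ↔-trans)
open import Level using (Level; _⊔_; 0ℓ) renaming (suc to lsuc)
open import Relation.Binary.Bundles using (Setoid)
open import Relation.Binary.PropositionalEquality as ≡ using (_≡_; _≗_; refl)
open import Relation.Nullary.Decidable using (Dec; yes; no; _×-dec_)
open import Relation.Unary using (Pred)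

private variable
  a c ℓ : Level
  A B : Set a

-- u tends to 0 along the filter with base tail 0 ⊇ tail 1 ⊇ …
Vanishing : {I : Set} → (ℕ → I → Set) → (I → ℚ) → Set
Vanishing tail u = ∀ ε → 0ℚ ℚ.< ε → ∃[ N ] (∀ i → tail N i → ℚ.∣ u i ∣ ℚ.< ε)

Tail : ℕ → ℕ → Set
Tail N n = N ≤ n

Tail² : ℕ → ℕ × ℕ → Set
Tail² N (m , n) = N ≤ m × N ≤ n

Cauchy : (ℕ → ℚ) → Set
Cauchy x = Vanishing Tail² (λ (m , n) → x m ℚ.- x n)

record ℝ : Set where
  constructor mkℝ
  field
    seq    : ℕ → ℚ
    cauchy : Cauchy seq

open ℝ public

infix 4 _≈ᴿ_

_≈ᴿ_ : ℝ → ℝ → Set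
x ≈ᴿ y = Vanishing Tail (λ n → seq x n ℚ.- seq y n)

private
  module Vanishes {I : Set} (tail : ℕ → I → Set)
    (mono : ∀ {M N} i → M ≤ N → tail N i → tail M i) where

    open ℚ.≤-Reasoning

    Bounded : (I → ℚ) → Set
    Bounded u = ∃[ b ] (0ℚ ℚ.< b × ∃[ N ] (∀ i → tail N i → ℚ.∣ u i ∣ ℚ.< b))

    cong : ∀ {u v} → u ≗ v → Vanishing tail u → Vanishing tail v
    cong u≗v V ε ε>0 with V ε ε>0
    ... | N , h = N , λ i t → ≡.subst (λ q → ℚ.∣ q ∣ ℚ.< ε) (u≗v i) (h i t)

    null : ∀ {u} → (∀ i → u i ≡ 0ℚ) → Vanishing tail u
    null u≗0 ε ε>0 = 0 , λ i _ → ≡.subst (λ q → ℚ.∣ q ∣ ℚ.< ε) (≡.sym (u≗0 i)) ε>0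

    neg : ∀ {u} → Vanishing tail u → Vanishing tail (λ i → ℚ.- u i)
    neg {u} V ε ε>0 with V ε ε>0
    ... | N , h = N , λ i t → ≡.subst (ℚ._< ε) (≡.sym (ℚ.∣-p∣≡∣p∣ (u i))) (h i t)

    half : ∀ ε → ½ ℚ.* ε ℚ.+ ½ ℚ.* ε ≡ ε
    half ε = ≡.trans (≡.sym (ℚ.*-distribʳ-+ ε ½ ½)) (ℚ.*-identityˡ ε)

    half>0 : ∀ {ε} → 0ℚ ℚ.< ε → 0ℚ ℚ.< ½ ℚ.* ε
    half>0 {ε} ε>0 = ≡.subst (ℚ._< ½ ℚ.* ε) (ℚ.*-zeroʳ ½) (ℚ.*-monoʳ-<-pos ½ ε>0)

    add : ∀ {u v} → Vanishing tail u → Vanishing tail v →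
          Vanishing tail (λ i → u i ℚ.+ v i)
    add {u} {v} U V ε ε>0 with U (½ ℚ.* ε) (half>0 ε>0) | V (½ ℚ.* ε) (half>0 ε>0)
    ... | M , g | N , h = M ℕ.⊔ N , λ i t → begin-strict
      ℚ.∣ u i ℚ.+ v i ∣          ≤⟨ ℚ.∣p+q∣≤∣p∣+∣q∣ (u i) (v i) ⟩
      ℚ.∣ u i ∣ ℚ.+ ℚ.∣ v i ∣    <⟨ ℚ.+-mono-< (g i (mono i (ℕ.m≤m⊔n M N) t))
                                               (h i (mono i (ℕ.m≤n⊔m M N) t)) ⟩
      ½ ℚ.* ε ℚ.+ ½ ℚ.* ε        ≡⟨ half ε ⟩
      ε                          ∎

    mul : ∀ {u v} → Bounded u → Vanishing tail v →
          Vanishing tail (λ i → u i ℚ.* v i)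
    mul {u} {v} (b , b>0 , M , g) V ε ε>0 = M ℕ.⊔ N , λ i t →
      let u<b = g i (mono i (ℕ.m≤m⊔n M N) t)
          v<δ = h i (mono i (ℕ.m≤n⊔m M N) t)
      in begin-strict
      ℚ.∣ u i ℚ.* v i ∣          ≡⟨ ℚ.∣p*q∣≡∣p∣*∣q∣ (u i) (v i) ⟩
      ℚ.∣ u i ∣ ℚ.* ℚ.∣ v i ∣    ≤⟨ ℚ.*-monoʳ-≤-nonNeg ℚ.∣ v i ∣
                                      {{ℚ.nonNegative (ℚ.0≤∣p∣ (v i))}} (ℚ.<⇒≤ u<b) ⟩
      b ℚ.* ℚ.∣ v i ∣            <⟨ ℚ.*-monoʳ-<-pos b v<δ ⟩
      b ℚ.* (ℚ.1/ b ℚ.* ε)       ≡⟨ ℚ.*-assoc b (ℚ.1/ b) ε ⟨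
      b ℚ.* ℚ.1/ b ℚ.* ε         ≡⟨ ≡.cong (ℚ._* ε) (ℚ.*-inverseʳ b) ⟩
      1ℚ ℚ.* ε                   ≡⟨ ℚ.*-identityˡ ε ⟩
      ε                          ∎
      where
      instance
        b⁺ : ℚ.Positive b
        b⁺ = ℚ.positive b>0
        b≢0 : ℚ.NonZero b
        b≢0 = ℚ.pos⇒nonZero b
        b⁻¹⁺ : ℚ.Positive (ℚ.1/ b)
        b⁻¹⁺ = ℚ.1/pos⇒pos b
      δ>0 : 0ℚ ℚ.< ℚ.1/ b ℚ.* ε
      δ>0 = ≡.subst (ℚ._< ℚ.1/ b ℚ.* ε) (ℚ.*-zeroʳ (ℚ.1/ b)) (ℚ.*-monoʳ-<-pos (ℚ.1/ b) ε>0)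
      N = proj₁ (V (ℚ.1/ b ℚ.* ε) δ>0)
      h = proj₂ (V (ℚ.1/ b ℚ.* ε) δ>0)

  module V  = Vanishes Tail (λ _ → ℕ.≤-trans)
  module V² = Vanishes Tail² (λ _ M≤N (p , q) → ℕ.≤-trans M≤N p , ℕ.≤-trans M≤N q)

  bounded : ∀ x → V.Bounded (seq x)
  bounded x with cauchy x 1ℚ (ℚ.positive⁻¹ 1ℚ)
  ... | N , h = 1ℚ ℚ.+ ℚ.∣ seq x N ∣
              , ℚ.+-mono-<-≤ (ℚ.positive⁻¹ 1ℚ) (ℚ.0≤∣p∣ (seq x N))
              , N , λ n N≤n → begin-strict
    ℚ.∣ seq x n ∣                                     ≡⟨ ≡.cong ℚ.∣_∣ (split (seq x n) (seq x N)) ⟩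
    ℚ.∣ (seq x n ℚ.- seq x N) ℚ.+ seq x N ∣           ≤⟨ ℚ.∣p+q∣≤∣p∣+∣q∣ (seq x n ℚ.- seq x N) (seq x N) ⟩
    ℚ.∣ seq x n ℚ.- seq x N ∣ ℚ.+ ℚ.∣ seq x N ∣       <⟨ ℚ.+-monoˡ-< _ (h (n , N) (N≤n , ℕ.≤-refl)) ⟩
    1ℚ ℚ.+ ℚ.∣ seq x N ∣                              ∎
    where
    open ℚ.≤-Reasoning
    open ℚ.+-*-Solver
    split : ∀ p q → p ≡ (p ℚ.- q) ℚ.+ q
    split = solve 2 (λ p q → p := (p :- q) :+ q) refl

  weakenˡ : ∀ {u} → V.Bounded u → V².Bounded (u ∘ proj₁)
  weakenˡ (b , b>0 , N , h) = b , b>0 , N , λ (m , n) (p , q) → h m p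

  weakenʳ : ∀ {u} → V.Bounded u → V².Bounded (u ∘ proj₂)
  weakenʳ (b , b>0 , N , h) = b , b>0 , N , λ (m , n) (p , q) → h n q

  swap-terms : ∀ p q r s → (p ℚ.- r) ℚ.+ (q ℚ.- s) ≡ (p ℚ.+ q) ℚ.- (r ℚ.+ s)
  swap-terms = solve 4 (λ p q r s → (p :- r) :+ (q :- s) := (p :+ q) :- (r :+ s)) refl
    where open ℚ.+-*-Solver

  neg-terms : ∀ p q → ℚ.- (p ℚ.- q) ≡ (ℚ.- p) ℚ.- (ℚ.- q)
  neg-terms = solve 2 (λ p q → :- (p :- q) := (:- p) :- (:- q)) refl
    where open ℚ.+-*-Solver

  mul-terms : ∀ p q r s →
    p ℚ.* (q ℚ.- s) ℚ.+ s ℚ.* (p ℚ.- r) ≡ p ℚ.* q ℚ.- r ℚ.* s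
  mul-terms = solve 4 (λ p q r s → p :* (q :- s) :+ s :* (p :- r) := p :* q :- r :* s) refl
    where open ℚ.+-*-Solver

infixl 6 _+ᴿ_
infixl 7 _*ᴿ_

_+ᴿ_ _*ᴿ_ : ℝ → ℝ → ℝ
seq    (x +ᴿ y) n = seq x n ℚ.+ seq y n
cauchy (x +ᴿ y) =
  V².cong (λ (m , n) → swap-terms (seq x m) (seq y m) (seq x n) (seq y n))
    (V².add (cauchy x) (cauchy y))
seq    (x *ᴿ y) n = seq x n ℚ.* seq y n
cauchy (x *ᴿ y) =
  V².cong (λ (m , n) → mul-terms (seq x m) (seq y m) (seq x n) (seq y n))
    (V².add (V².mul (weakenˡ (bounded x)) (cauchy y))
            (V².mul (weakenʳ (bounded y)) (cauchy x)))

-ᴿ_ : ℝ → ℝ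
seq    (-ᴿ x) n = ℚ.- seq x n
cauchy (-ᴿ x) = V².cong (λ (m , n) → neg-terms (seq x m) (seq x n)) (V².neg (cauchy x))

fromℚ : ℚ → ℝ
seq    (fromℚ q) _ = q
cauchy (fromℚ q) = V².null (λ _ → ℚ.+-inverseʳ q)

fromℤ : ℤ → ℝ
fromℤ z = fromℚ (z ℚ./ 1)

private
  pointwise : ∀ x y → seq x ≗ seq y → x ≈ᴿ y
  pointwise x y x≗y =
    V.null (λ n → ≡.trans (≡.cong (ℚ._- seq y n) (x≗y n)) (ℚ.+-inverseʳ (seq y n)))

ℝ-commutativeRing : CommutativeRing 0ℓ 0ℓ
ℝ-commutativeRing = record
  { Carrier = ℝ ; _≈_ = _≈ᴿ_ ; _+_ = _+ᴿ_ ; _*_ = _*ᴿ_ ; -_ = -ᴿ_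
  ; 0# = fromℚ 0ℚ ; 1# = fromℚ 1ℚ
  ; isCommutativeRing = record
    { isRing = record
      { +-isAbelianGroup = record
        { isGroup = record
          { isMonoid = record
            { isSemigroup = record
              { isMagma = record
                { isEquivalence = record
                  { refl  = λ {x} → pointwise x x (λ _ → refl)
                  ; sym   = λ {x} {y} p →
                      V.cong (λ n → flip-terms (seq x n) (seq y n)) (V.neg p)
                  ; trans = λ {x} {y} {z} p q →
                      V.cong (λ n → telescope (seq x n) (seq y n) (seq z n)) (V.add p q)
                  }
                ; ∙-cong = λ {x} {x′} {y} {y′} p q →
                    V.cong (λ n → swap-terms (seq x n) (seq y n) (seq x′ n) (seq y′ n)) (V.add p q)
                }
              ; assoc = λ x y z → pointwise ((x +ᴿ y) +ᴿ z) (x +ᴿ (y +ᴿ z))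
                  (λ n → ℚ.+-assoc (seq x n) (seq y n) (seq z n))
              }
            ; identity = (λ x → pointwise (fromℚ 0ℚ +ᴿ x) x (λ n → ℚ.+-identityˡ (seq x n)))
                       , (λ x → pointwise (x +ᴿ fromℚ 0ℚ) x (λ n → ℚ.+-identityʳ (seq x n)))
            }
          ; inverse = (λ x → pointwise ((-ᴿ x) +ᴿ x) (fromℚ 0ℚ) (λ n → ℚ.+-inverseˡ (seq x n)))
                    , (λ x → pointwise (x +ᴿ (-ᴿ x)) (fromℚ 0ℚ) (λ n → ℚ.+-inverseʳ (seq x n)))
          ; ⁻¹-cong = λ {x} {y} p →
              V.cong (λ n → neg-terms (seq x n) (seq y n)) (V.neg p)
          }
        ; comm = λ x y → pointwise (x +ᴿ y) (y +ᴿ x) (λ n → ℚ.+-comm (seq x n) (seq y n))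
        }
      ; *-cong = λ {x} {x′} {y} {y′} p q →
          V.cong (λ n → mul-terms (seq x n) (seq y n) (seq x′ n) (seq y′ n))
            (V.add (V.mul (bounded x) q) (V.mul (bounded y′) p))
      ; *-assoc = λ x y z → pointwise ((x *ᴿ y) *ᴿ z) (x *ᴿ (y *ᴿ z))
          (λ n → ℚ.*-assoc (seq x n) (seq y n) (seq z n))
      ; *-identity = (λ x → pointwise (fromℚ 1ℚ *ᴿ x) x (λ n → ℚ.*-identityˡ (seq x n)))
                   , (λ x → pointwise (x *ᴿ fromℚ 1ℚ) x (λ n → ℚ.*-identityʳ (seq x n)))
      ; distrib = (λ x y z → pointwise (x *ᴿ (y +ᴿ z)) (x *ᴿ y +ᴿ x *ᴿ z)
                     (λ n → ℚ.*-distribˡ-+ (seq x n) (seq y n) (seq z n)))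
                , (λ x y z → pointwise ((y +ᴿ z) *ᴿ x) (y *ᴿ x +ᴿ z *ᴿ x)
                     (λ n → ℚ.*-distribʳ-+ (seq x n) (seq y n) (seq z n)))
      }
    ; *-comm = λ x y → pointwise (x *ᴿ y) (y *ᴿ x) (λ n → ℚ.*-comm (seq x n) (seq y n))
    }
  }
  where
  open ℚ.+-*-Solver
  flip-terms : ∀ p q → ℚ.- (p ℚ.- q) ≡ q ℚ.- p
  flip-terms = solve 2 (λ p q → :- (p :- q) := q :- p) refl
  telescope : ∀ p q r → (p ℚ.- q) ℚ.+ (q ℚ.- r) ≡ p ℚ.- r
  telescope = solve 3 (λ p q r → (p :- q) :+ (q :- r) := p :- r) refl

record Finite (A : Set a) : Set a where
  field
    {size} : ℕ
    enum   : Fin size ↔ A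

open Finite {{...}} public

private
  finite-↔ : A ↔ B → Finite A → Finite B
  finite-↔ A↔B fin = record { enum = ↔-trans (Finite.enum fin) A↔B }

  finite-⊎ : Finite A → Finite B → Finite (A ⊎ B)
  finite-⊎ finA finB = record
    { enum = ↔-trans Fin.+↔⊎ (Finite.enum finA ⊎-cong Finite.enum finB) }

instance
  finite-Fin : ∀ {n} → Finite (Fin n)
  finite-Fin = record { enum = ↔-refl }

  finite-Subset : ∀ {n} → Finite (Subset n)
  finite-Subset {zero}  = record { enum = mk↔ₛ′
    (λ (_ : Fin 1) → []) (λ _ → zero) (λ { [] → refl }) (λ { zero → refl }) }
  finite-Subset {suc n} = finite-↔ cons (finite-⊎ finite-Subset finite-Subset)
    where
    cons : (Subset n ⊎ Subset n) ↔ Subset (suc n)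
    cons = mk↔ₛ′ (λ { (inj₁ s) → false ∷ s ; (inj₂ s) → true ∷ s })
                 (λ { (false ∷ s) → inj₁ s ; (true ∷ s) → inj₂ s })
                 (λ { (false ∷ s) → refl ; (true ∷ s) → refl })
                 (λ { (inj₁ s) → refl ; (inj₂ s) → refl })

Sub : Set a → Set a
Sub A = A → Bool

El : {A : Set a} → Sub A → Set a
El {A = A} S = [ x ∈ A ∣ T (S x) ]

infix 9 _ᶜ

_ᶜ : Sub A → Sub A
(S ᶜ) x = not (S x)

private
  finite-El-Fin : ∀ {n} (S : Sub (Fin n)) → Finite (El S)
  finite-El-Fin {zero}  S = record { enum = mk↔ₛ′ (λ (i : Fin 0) → ⊥-elim (¬Fin0 i)) (λ { (() , _) })
                                     (λ { (() , _) }) (λ ()) }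
    where
    ¬Fin0 : Fin 0 → ⊥
    ¬Fin0 ()
  finite-El-Fin {suc n} S with S zero in eq | finite-El-Fin (S ∘ suc)
  ... | true  | fin = record { enum = mk↔ₛ′
          (λ { zero    → zero , [ ≡.subst T (≡.sym eq) tt ]
             ; (suc i) → inc (Inverse.to (Finite.enum fin) i) })
          (λ { (zero  , _) → zero
             ; (suc i , p) → suc (Inverse.from (Finite.enum fin) (i , p)) })
          (λ { (zero  , _) → refl
             ; (suc i , p) → ≡.cong inc (Inverse.strictlyInverseˡ (Finite.enum fin) (i , p)) })
          (λ { zero    → refl
             ; (suc i) → ≡.cong suc (Inverse.strictlyInverseʳ (Finite.enum fin) i) }) }
    where
    inc : El (S ∘ suc) → El S
    inc (i , p) = suc i , p
  ... | false | fin = finite-↔ (mk↔ₛ′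
          (λ (i , p) → suc i , p)
          (λ { (zero , [ p ]) → absurd p ; (suc i , p) → i , p })
          (λ { (zero , [ p ]) → absurd p ; (suc i , p) → refl })
          (λ _ → refl)) fin
    where
    absurd : ∀ {w} {W : Set w} → .(T (S zero)) → W
    absurd p = irr-elim (≡.subst T eq p)
      where
      irr-elim : ∀ {w} {W : Set w} → .(T false) → W
      irr-elim ()

instance
  finite-El : {A : Set a} {{_ : Finite A}} {S : Sub A} → Finite (El S)
  finite-El {{fin}} {S} = finite-↔ (mk↔ₛ′
      (λ (i , p) → to i , p)
      (λ (x , [ p ]) → from x , [ ≡.subst (T ∘ S) (≡.sym (strictlyInverseˡ x)) p ])
      (λ (x , [ p ]) → El-≡ (strictlyInverseˡ x))
      (λ (i , [ p ]) → El-≡ (strictlyInverseʳ i)))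
    (finite-El-Fin (S ∘ to))
    where
    open Inverse (Finite.enum fin)
    El-≡ : ∀ {b} {B : Set b} {Q : Sub B} {x y : El Q} → value x ≡ value y → x ≡ y
    El-≡ refl = refl

module BigOp {c ℓ} (M : CommutativeMonoid c ℓ) where
  open CommutativeMonoid M using (Carrier)

  ⨁ : {A : Set a} {{_ : Finite A}} → (A → Carrier) → Carrier
  ⨁ f = Sum.sum M (f ∘ Inverse.to enum)

private
  module ∑-properties {A : Set} {{fin : Finite A}} where
    open BigOp ℤ.+-0-commutativeMonoid
    open Sum ℤ.+-0-commutativeMonoid

    ∑-cong : {f g : A → ℤ} → f ≗ g → ⨁ f ≡ ⨁ g
    ∑-cong f≗g = sum-cong-≗ (f≗g ∘ Inverse.to enum)

    ∑-zero : ⨁ {A = A} (λ _ → 0ℤ) ≡ 0ℤ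
    ∑-zero = sum-replicate-zero (Finite.size fin)

    ∑-add : (f g : A → ℤ) → ⨁ (λ x → f x +ᶻ g x) ≡ ⨁ f +ᶻ ⨁ g
    ∑-add f g = ∑-distrib-+ (f ∘ Inverse.to enum) (g ∘ Inverse.to enum)

open BigOp ℤ.+-0-commutativeMonoid public renaming (⨁ to ∑)
open BigOp ℤ.*-1-commutativeMonoid public renaming (⨁ to ∏)

_HasCardinality_ : Setoid c ℓ → ℕ → Set (c ⊔ ℓ)
S HasCardinality N = Inverse (≡.setoid (Fin N)) S

-- S is finite, and z is the sum of f over S.
SumOver : (S : Setoid c ℓ) → (Setoid.Carrier S → ℤ) → ℤ → Set (c ⊔ ℓ)
SumOver S f z =
  ∃[ N ] Σ (S HasCardinality N) λ e → ∑ (f ∘ Inverse.to e) ≡ z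

module LinearAlgebra {c ℓ} (K : CommutativeRing c ℓ) where
  open CommutativeRing K
  open BigOp +-commutativeMonoid

  combination : {I J : Set} {{_ : Finite I}} → (I → Carrier) → (I → J → Carrier) → J → Carrier
  combination x v j = ⨁ λ i → x i * v i j

  LinearlyIndependent : {I J : Set} {{_ : Finite I}} → (I → J → Carrier) → Set (c ⊔ ℓ)
  LinearlyIndependent v = ∀ x → (∀ j → combination x v j ≈ 0#) → ∀ i → x i ≈ 0#

  Span : {I J : Set} {{_ : Finite I}} → (I → J → Carrier) → Pred (J → Carrier) (c ⊔ ℓ)
  Span v w = ∃[ x ] ∀ j → w j ≈ combination x v j

  IsBasisOf : {I J : Set} {{_ : Finite I}} → (I → J → Carrier) → Pred (J → Carrier) (c ⊔ ℓ) →
              Set (c ⊔ ℓ)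
  IsBasisOf v W = LinearlyIndependent v × (∀ w → Span v w ⇔ W w)

Matrix : Set → Set → Set
Matrix I J = I → J → ℤ

-- Laplace expansion along the first row.
det : ∀ {m} → Matrix (Fin m) (Fin m) → ℤ
det {zero}  M = 1ℤ
det {suc m} M = ∑ λ (j : Fin (suc m)) →
  -1ℤ ^ toℕ j *ᶻ (M zero j *ᶻ det (λ i k → M (suc i) (punchIn j k)))

signum : ℤ → ℤ
signum +0       = 0ℤ
signum +[1+ _ ] = 1ℤ
signum -[1+ _ ] = -1ℤ

permSign : ∀ {m} → Permutation′ m → ℤ
permSign {m} π = -1ℤ ^ length (filter inversion? pairs)
  where
  pairs : List (Fin m × Fin m)
  pairs = cartesianProduct (allFin m) (allFin m)
  inversion? : (ij : Fin m × Fin m) →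
    Dec (proj₁ ij Fin.< proj₂ ij × π ⟨$⟩ʳ proj₂ ij Fin.< π ⟨$⟩ʳ proj₁ ij)
  inversion? (i , j) = (i Fin.<? j) ×-dec ((π ⟨$⟩ʳ j) Fin.<? (π ⟨$⟩ʳ i))

record Subgroup (G : AbelianGroup c ℓ) p : Set (c ⊔ ℓ ⊔ lsuc p) where
  open AbelianGroup G
  field
    Member    : Pred Carrier p
    resp      : ∀ {x y} → x ≈ y → Member x → Member y
    ε-closed  : Member ε
    ∙-closed  : ∀ {x y} → Member x → Member y → Member (x ∙ y)
    ⁻¹-closed : ∀ {x} → Member x → Member (x ⁻¹)

infixl 7 _/_

_/_ : ∀ {p} (G : AbelianGroup c ℓ) → Subgroup G p → AbelianGroup c p
_/_ {p = p} G N = record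
  { Carrier = Carrier ; _≈_ = _∼_ ; _∙_ = _∙_ ; ε = ε ; _⁻¹ = _⁻¹
  ; isAbelianGroup = record
    { isGroup = record
      { isMonoid = record
        { isSemigroup = record
          { isMagma = record
            { isEquivalence = record
              { refl  = ≈⇒∼ ≈-refl
              ; sym   = λ {x} {y} p → resp (⁻¹-anti-homo‿- x y) (⁻¹-closed p)
              ; trans = λ {x} {y} {z} p q → resp (telescope x y z) (∙-closed p q)
              }
            ; ∙-cong = λ {x} {x′} {y} {y′} p q → resp (swap-terms′ x y x′ y′) (∙-closed p q)
            }
          ; assoc = λ x y z → ≈⇒∼ (assoc x y z)
          }
        ; identity = ≈⇒∼ ∘ identityˡ , ≈⇒∼ ∘ identityʳ
        }
      ; inverse = ≈⇒∼ ∘ inverseˡ , ≈⇒∼ ∘ inverseʳ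
      ; ⁻¹-cong = λ {x} {y} p → resp (sym (⁻¹-∙-comm x (y ⁻¹))) (⁻¹-closed p)
      }
    ; comm = λ x y → ≈⇒∼ (comm x y)
    }
  }
  where
  open AbelianGroup G renaming (refl to ≈-refl)
  open Subgroup N
  open Algebra.Properties.AbelianGroup G
  open import Algebra.Solver.CommutativeMonoid commutativeMonoid
  open import Relation.Binary.Reasoning.Setoid setoid

  _∼_ : Carrier → Carrier → Set p
  x ∼ y = Member (x ∙ y ⁻¹)

  ≈⇒∼ : ∀ {x y} → x ≈ y → x ∼ y
  ≈⇒∼ {x} {y} x≈y = resp (sym (trans (∙-congʳ x≈y) (inverseʳ y))) ε-closed

  telescope : ∀ x y z → (x ∙ y ⁻¹) ∙ (y ∙ z ⁻¹) ≈ x ∙ z ⁻¹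
  telescope x y z = begin
    (x ∙ y ⁻¹) ∙ (y ∙ z ⁻¹)  ≈⟨ solve 4 (λ a b b′ d → (a ⊕ b′) ⊕ (b ⊕ d) ⊜ (a ⊕ d) ⊕ (b ⊕ b′))
                                  ≈-refl x y (y ⁻¹) (z ⁻¹) ⟩
    (x ∙ z ⁻¹) ∙ (y ∙ y ⁻¹)  ≈⟨ ∙-congˡ (inverseʳ y) ⟩
    (x ∙ z ⁻¹) ∙ ε           ≈⟨ identityʳ _ ⟩
    x ∙ z ⁻¹                 ∎

  swap-terms′ : ∀ x y x′ y′ → (x ∙ x′ ⁻¹) ∙ (y ∙ y′ ⁻¹) ≈ (x ∙ y) ∙ (x′ ∙ y′) ⁻¹
  swap-terms′ x y x′ y′ = begin
    (x ∙ x′ ⁻¹) ∙ (y ∙ y′ ⁻¹)  ≈⟨ solve 4 (λ a a′ b b′ → (a ⊕ a′) ⊕ (b ⊕ b′) ⊜ (a ⊕ b) ⊕ (a′ ⊕ b′))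
                                    ≈-refl x (x′ ⁻¹) y (y′ ⁻¹) ⟩
    (x ∙ y) ∙ (x′ ⁻¹ ∙ y′ ⁻¹)  ≈⟨ ∙-congˡ (⁻¹-∙-comm x′ y′) ⟩
    (x ∙ y) ∙ (x′ ∙ y′) ⁻¹     ∎

record Hom {c₁ ℓ₁ c₂ ℓ₂} (G : AbelianGroup c₁ ℓ₁) (H : AbelianGroup c₂ ℓ₂) :
    Set (c₁ ⊔ ℓ₁ ⊔ c₂ ⊔ ℓ₂) where
  private
    module G = AbelianGroup G
    module H = AbelianGroup H
  open GroupMorphisms G.rawGroup H.rawGroup
  field
    ⟦_⟧                 : G.Carrier → H.Carrier
    isGroupHomomorphism : IsGroupHomomorphism ⟦_⟧

  open IsGroupHomomorphism isGroupHomomorphism public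

image : ∀ {c₁ ℓ₁ c₂ ℓ₂} {G : AbelianGroup c₁ ℓ₁} {H : AbelianGroup c₂ ℓ₂} →
        Hom G H → Subgroup H (c₁ ⊔ ℓ₂)
image {G = G} {H} f = record
  { Member    = λ y → ∃[ x ] ⟦ x ⟧ H.≈ y
  ; resp      = λ y≈y′ (x , p) → x , H.trans p y≈y′
  ; ε-closed  = G.ε , ε-homo
  ; ∙-closed  = λ (x , p) (x′ , p′) → x G.∙ x′ , H.trans (homo x x′) (H.∙-cong p p′)
  ; ⁻¹-closed = λ (x , p) → x G.⁻¹ , H.trans (⁻¹-homo x) (H.⁻¹-cong p)
  }
  where
  module G = AbelianGroup G
  module H = AbelianGroup H
  open Hom f

coker : ∀ {c₁ ℓ₁ c₂ ℓ₂} {G : AbelianGroup c₁ ℓ₁} {H : AbelianGroup c₂ ℓ₂} →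
        Hom G H → AbelianGroup c₂ (c₁ ⊔ ℓ₂)
coker {H = H} f = H / image f

-- Free on A only when A is finite: there is no support condition.
ℤ[_] : Set → AbelianGroup 0ℓ 0ℓ
ℤ[ A ] = Pointwise.abelianGroup A ℤ.+-0-abelianGroup

-- ℤS ⊆ ℤA, for S ⊆ A.
spannedBy : {A : Set} → Sub A → Subgroup ℤ[ A ] 0ℓ
spannedBy S = record
  { Member    = λ x → ∀ i → T ((S ᶜ) i) → x i ≡ 0ℤ
  ; resp      = λ x≈y p i q → ≡.trans (≡.sym (x≈y i)) (p i q)
  ; ε-closed  = λ _ _ → refl
  ; ∙-closed  = λ p p′ i q → ≡.cong₂ _+ᶻ_ (p i q) (p′ i q)
  ; ⁻¹-closed = λ p i q → ≡.cong -ᶻ_ (p i q)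
  }

record SimplicialComplex (n : ℕ) : Set where
  field
    isFace   : Sub (Subset n)
    nonempty : ∃[ s ] T (isFace s)
    closed   : ∀ {s t} → s ⊆ t → T (isFace t) → T (isFace s)

open SimplicialComplex public

-- Indexed by cardinality: Face G k is the set of (k - 1)-dimensional faces.
Face : ∀ {n} → SimplicialComplex n → ℕ → Set
Face G k = El (λ s → isFace G s ∧ (∣ s ∣ ℕ.≡ᵇ k))

HasDimension : ∀ {n} → SimplicialComplex n → ℕ → Set
HasDimension G d =
  (∃[ s ] T (isFace G s) × ∣ s ∣ ≡ suc d) × (∀ s → T (isFace G s) → ∣ s ∣ ≤ suc d)

-- In increasing order, since allFin is.
vertices : ∀ {n} → Subset n → List (Fin n)
vertices {n} s = filter (_∈? s) (allFin n)

-- Meant for ∣ f ∣ ≡ suc ∣ r ∣, when r ⊈ f says that no such j exists.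
incidence : ∀ {n} → Subset n → Subset n → ℤ
incidence r f with Fin.any? (λ j → Vec.≡-dec Bool._≟_ r (f - lookup (vertices f) j))
... | yes (j , _) = -1ℤ ^ toℕ j
... | no  _       = 0ℤ

∂ : ∀ {n} (G : SimplicialComplex n) {k} → Matrix (Face G k) (Face G (suc k))
∂ G r f = incidence (value r) (value f)

open LinearAlgebra ℝ-commutativeRing public

-- Only meant for d the dimension of G.
module _ {n} (G : SimplicialComplex n) {d : ℕ} where

  column : (F : Sub (Face G (suc d))) → El F → Face G d → ℝ
  column F f r = fromℤ (∂ G r (value f))

  row : (F : Sub (Face G (suc d))) (S : Sub (Face G d)) → El S → El F → ℝ
  row F S r f = fromℤ (∂ G (value r) (value f))

  IsForest : Sub (Face G (suc d)) → Set
  IsForest F = LinearlyIndependent (column F)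

  RowSpace : (F : Sub (Face G (suc d))) → Pred (El F → ℝ) 0ℓ
  RowSpace F = Span {I = Face G d} (λ r f → fromℤ (∂ G r (value f)))

  IsRoot : Sub (Face G (suc d)) → Sub (Face G d) → Set
  IsRoot F R = IsBasisOf (row F (R ᶜ)) (RowSpace F)

  IsRootedForest : Sub (Face G (suc d)) → Sub (Face G d) → Set
  IsRootedForest F R = IsForest F × IsRoot F R

module _ {n} (G : SimplicialComplex n) {d : ℕ} (F : Sub (Face G (suc d))) (R : Sub (Face G d)) where

  boundary : (El F → ℤ) → Face G d → ℤ
  boundary x r = ∑ λ f → x f *ᶻ ∂ G r (value f)

  Ψ : Hom ℤ[ El F ] (ℤ[ Face G d ] / spannedBy R)
  Ψ = record
    { ⟦_⟧ = boundary
    ; isGroupHomomorphism = record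
      { isMonoidHomomorphism = record
        { isMagmaHomomorphism = record
          { isRelHomomorphism = record { cong = λ p → ≈⇒∼ (cong p) }
          ; homo = λ x y → ≈⇒∼ (homo x y)
          }
        ; ε-homo = ≈⇒∼ ε-homo
        }
      ; ⁻¹-homo = λ x → ≈⇒∼ (⁻¹-homo x)
      }
    }
    where
    open ∑-properties
    module Z = AbelianGroup ℤ[ Face G d ]
    ≈⇒∼ : ∀ {x y} → x Z.≈ y → AbelianGroup._≈_ (ℤ[ Face G d ] / spannedBy R) x y
    ≈⇒∼ {x} {y} x≈y r _ = ℤ.i≡j⇒i-j≡0 (x≈y r)
    cong : ∀ {x y} → (∀ f → x f ≡ y f) → ∀ r → boundary x r ≡ boundary y r
    cong p r = ∑-cong (λ f → ≡.cong (_*ᶻ ∂ G r (value f)) (p f))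
    homo : ∀ x y r → boundary (λ f → x f +ᶻ y f) r ≡ boundary x r +ᶻ boundary y r
    homo x y r = ≡.trans
      (∑-cong (λ f → ℤ.*-distribʳ-+ (∂ G r (value f)) (x f) (y f)))
      (∑-add (λ f → x f *ᶻ ∂ G r (value f)) (λ f → y f *ᶻ ∂ G r (value f)))
    ε-homo : ∀ r → boundary (λ _ → 0ℤ) r ≡ 0ℤ
    ε-homo r = ≡.trans (∑-cong (λ (f : El F) → ℤ.*-zeroˡ (∂ G r (value f)))) (∑-zero {El F})
    ⁻¹-homo : ∀ x r → boundary (λ f → -ᶻ x f) r ≡ -ᶻ boundary x r
    ⁻¹-homo x r = inverseˡ-unique (boundary (λ f → -ᶻ x f) r) (boundary x r)
      (≡.trans (≡.sym (homo (λ f → -ᶻ x f) x r))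
        (≡.trans (cong (λ f → ℤ.+-inverseˡ (x f)) r) (ε-homo r)))
      where open Algebra.Properties.AbelianGroup ℤ.+-0-abelianGroup

  RelativeHomology : AbelianGroup 0ℓ 0ℓ
  RelativeHomology = coker Ψ

  record FittingOrientation : Set where
    field
      bijection : El (R ᶜ) ↔ El F
      fits      : ∀ r → value (value r) ⊆ value (value (Inverse.to bijection r))

    apply : El (R ᶜ) → El F
    apply = Inverse.to bijection

  open FittingOrientation public

  FittingOrientations : Setoid 0ℓ 0ℓ
  FittingOrientations = record
    { Carrier = FittingOrientation
    ; _≈_ = λ φ ψ → apply φ ≗ apply ψ
    ; isEquivalence = record
      { refl  = λ _ → refl
      ; sym   = λ p r → ≡.sym (p r)
      ; trans = λ p q r → ≡.trans (p r) (q r)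
      }
    }

  module _ {m} (α : Fin m ↔ El (R ᶜ)) (β : Fin m ↔ El F) where

    orderedMatrix : Matrix (Fin m) (Fin m)
    orderedMatrix i j = ∂ G (value (Inverse.to α i)) (value (Inverse.to β j))

    orderSign : ℤ
    orderSign = signum (det orderedMatrix)

    π[_] : FittingOrientation → Permutation′ m
    π[ φ ] = ↔-trans α (↔-trans (bijection φ) (↔-sym β))

    unnormalisedSign : FittingOrientation → ℤ
    unnormalisedSign φ = permSign π[ φ ] *ᶻ ∏ λ r → ∂ G (value r) (value (apply φ r))

    Λ : FittingOrientation → ℤ
    Λ φ = orderSign *ᶻ unnormalisedSign φ

{-# OPTIONS --safe #-}

-- By the Leibniz formula the signs of all fitting orientations, before normalisation, sum to the
-- determinant of the ordered incidence matrix: a bijection R̄ → F that does not fit meets a zero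
-- entry. Elementary column operations change neither this determinant nor the lattice spanned by
-- the columns. They clear the first row up to one entry d, so that the index of the lattice is |d|
-- times the index for the remaining minor, unless d or the minor vanishes, when the rows satisfy an
-- integer relation. Linear independence of the rows over ℝ excludes the latter, and the index is
-- |H_{d-1}(F,R)|. Reordering R̄ and F multiplies every summand by one sign, by multiplicativity
-- of the permutation sign, hence the determinant by the same sign.
module Submission where

open import Defs
open import Algebra.Bundles using (AbelianGroup; CommutativeMonoid; CommutativeRing)
import Algebra.Properties.CommutativeMonoid.Sum as Sum
import Algebra.Properties.Semiring.Sum as SemiringSum
open import Data.Bool.Base using (Bool; true; false; T)
import Data.Bool.Properties as Bool
open import Data.Empty using (⊥-elim; ⊥-elim-irr)
open import Data.Fin.Base as Fin using (Fin; zero; suc; toℕ; punchIn; fromℕ<)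
open import Data.Fin.Permutation as Perm using (Permutation′; _⟨$⟩ʳ_; _∘ₚ_)
import Data.Fin.Properties as Fin
open import Data.Fin.Subset as Subset using (Subset; inside; outside; ⁅_⁆; _∈_; _⊆_)
  renaming (∣_∣ to card; _-_ to _∖_)
import Data.Fin.Subset.Properties as Subset
open import Data.Integer.Base
  using (ℤ; +_; +0; +[1+_]; -[1+_]; 0ℤ; 1ℤ; -1ℤ; ∣_∣; _⊖_; _^_; _+_; _*_; -_; _-_; ≢-nonZero)
import Data.Integer.DivMod as ℤ
import Data.Integer.Properties as ℤ
open import Data.Integer.Tactic.RingSolver using (solve-∀)
open import Data.Irrelevant using ([_])
open import Data.List.Base as List using (length; filter; cartesianProduct)
open import Data.List.Membership.Propositional.Properties using (∈-filter⁺; ∈-allFin)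
import Data.List.Properties as List
import Data.List.Relation.Unary.Any as Any
open import Data.List.Relation.Unary.Any.Properties using (lookup-index)
open import Data.Nat.Base as ℕ using (ℕ; zero; suc)
open import Data.Nat.Induction using (<-wellFounded)
import Data.Nat.Properties as ℕ
open import Data.Product.Base using (Σ; ∃-syntax; _×_; _,_; proj₁; proj₂; map₂; uncurry)
open import Data.Rational.Base as ℚ using (0ℚ)
import Data.Rational.Properties as ℚ
open import Data.Rational.Unnormalised.Base as ℚᵘ using (mkℚᵘ; *≡*)
import Data.Rational.Unnormalised.Properties as ℚᵘ
open import Data.Refinement using (_,_; value)
open import Data.Sum.Base using (_⊎_; inj₁; inj₂; [_,_]′)
open import Data.Sum.Function.Propositional using (_⊎-cong_)
open import Data.Unit.Base using (⊤; tt)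
open import Data.Vec.Base as Vec using (Vec; []; _∷_; lookup; tabulate; here; there)
import Data.Vec.Functional as Vector
import Data.Vec.Properties as Vec
open import Data.Vec.Relation.Unary.All as All using (All; []; _∷_)
import Data.Vec.Relation.Unary.All.Properties as All
open import Function.Base using (_∘_; id)
open import Function.Bundles using (_↔_; Inverse; Injection; Equivalence; mk↔ₛ′)
import Function.Construct.Composition as Composition
import Function.Construct.Symmetry as Symmetry
open import Function.Properties.Inverse using (↔⇒↣; ↔-sym; ↔-trans)
open import Induction.WellFounded using (Acc; acc)
open import Relation.Binary.Bundles using (Setoid)
open import Relation.Binary.Definitions using (tri<; tri≈; tri>)
open import Relation.Binary.PropositionalEquality as ≡
  using (_≡_; _≢_; _≗_; refl; sym; trans; cong; cong₂; subst; subst₂; module ≡-Reasoning)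
open import Relation.Nullary.Decidable using (Dec; yes; no; _×-dec_; recompute; T?; ⌊_⌋; toWitness; fromWitness)
open import Relation.Nullary.Negation using (¬_; contradiction)
open import Relation.Unary using (Decidable)

open Sum ℤ.+-0-commutativeMonoid using (sum)

-- Equality of Cauchy reals cannot be decided, so neither rank nor elimination is argued over ℝ. All
-- elimination takes place over ℤ, where tests for zero settle the cases, and every square matrix
-- receives one of two explicit outcomes: a nonzero integer row vector that kills all columns, or a
-- full list of coset representatives for the column lattice. The hypothesis over ℝ is consulted
-- only to refute the first outcome. `det` expands along rows, while the elimination acts on
-- columns. The expansion is therefore recast as an alternating form on the list of columns,
-- invariant under shears. As columns are neither swapped nor rescaled, no sign has to be tracked:
-- the determinant is exactly the pivot times the minor.

module Addition where
  open Sum ℤ.+-0-commutativeMonoid public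
  open SemiringSum ℤ.+-*-semiring public using (*-distribˡ-sum)

module Product = Sum ℤ.*-1-commutativeMonoid
open Product using () renaming (sum to product)

-- Signs of permutations

IsSign : ℤ → Set
IsSign z = z ≡ 1ℤ ⊎ z ≡ -1ℤ

sign-* : ∀ {x y} → IsSign x → IsSign y → IsSign (x * y)
sign-* (inj₁ refl) (inj₁ refl) = inj₁ refl
sign-* (inj₁ refl) (inj₂ refl) = inj₂ refl
sign-* (inj₂ refl) (inj₁ refl) = inj₂ refl
sign-* (inj₂ refl) (inj₂ refl) = inj₁ refl

sign-square : ∀ {x} → IsSign x → x * x ≡ 1ℤ
sign-square (inj₁ refl) = refl
sign-square (inj₂ refl) = refl

-1^-sign : ∀ k → IsSign (-1ℤ ^ k)
-1^-sign zero    = inj₁ refl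
-1^-sign (suc k) = sign-* (inj₂ refl) (-1^-sign k)

product-sign : ∀ {n} (f : Fin n → ℤ) → (∀ i → IsSign (f i)) → IsSign (product f)
product-sign {zero}  f s = inj₁ refl
product-sign {suc n} f s = sign-* (s zero) (product-sign (f ∘ suc) (s ∘ suc))

module _ {a} {A : Set a} where

  factor : Dec A → ℤ
  factor (yes _) = -1ℤ
  factor (no  _) = 1ℤ

  factor-yes : A → (d : Dec A) → factor d ≡ -1ℤ
  factor-yes x (yes _) = refl
  factor-yes x (no ¬x) = contradiction x ¬x

  factor-no : ¬ A → (d : Dec A) → factor d ≡ 1ℤ
  factor-no ¬x (yes x) = contradiction x ¬x
  factor-no ¬x (no _)  = refl

factor-sign : ∀ {a} {A : Set a} (d : Dec A) → IsSign (factor d)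
factor-sign (yes _) = inj₂ refl
factor-sign (no  _) = inj₁ refl

factor-cong : ∀ {a b} {A : Set a} {B : Set b} → (A → B) → (B → A) →
              (d : Dec A) (e : Dec B) → factor d ≡ factor e
factor-cong f g (yes x) e = sym (factor-yes (f x) e)
factor-cong f g (no ¬x) e = sym (factor-no (¬x ∘ g) e)

module _ {a p} {A : Set a} {P : A → Set p} (P? : Decidable P) where

  -1^length-filter-tabulate : ∀ {n} (h : Fin n → A) →
    -1ℤ ^ length (filter P? (List.tabulate h)) ≡ product (factor ∘ P? ∘ h)
  -1^length-filter-tabulate {zero}  h = refl
  -1^length-filter-tabulate {suc n} h with P? (h zero)
  ... | yes _ = cong (-1ℤ *_) (-1^length-filter-tabulate (h ∘ suc))
  ... | no  _ = trans (-1^length-filter-tabulate (h ∘ suc)) (sym (ℤ.*-identityˡ (product (factor ∘ P? ∘ h ∘ suc))))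

-- Turns the inversion count behind `permSign` into a double product of signs, which can be split,
-- regrouped and permuted like any product in a commutative monoid.
-1^length-filter-cartesianProduct :
  ∀ {A B : Set} {p} {P : A × B → Set p} (P? : Decidable P)
  {m n} (f : Fin m → A) (g : Fin n → B) →
  -1ℤ ^ length (filter P? (cartesianProduct (List.tabulate f) (List.tabulate g))) ≡
  product (λ i → product λ j → factor (P? (f i , g j)))
-1^length-filter-cartesianProduct P? {zero}  f g = refl
-1^length-filter-cartesianProduct P? {suc m} f g = begin
  -1ℤ ^ length (filter P? (xs List.++ ys))
    ≡⟨ cong (λ zs → -1ℤ ^ length zs) (List.filter-++ P? xs ys) ⟩
  -1ℤ ^ length (filter P? xs List.++ filter P? ys)
    ≡⟨ cong (-1ℤ ^_) (List.length-++ (filter P? xs)) ⟩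
  -1ℤ ^ (length (filter P? xs) ℕ.+ length (filter P? ys))
    ≡⟨ ℤ.^-distribˡ-+-* -1ℤ (length (filter P? xs)) (length (filter P? ys)) ⟩
  -1ℤ ^ length (filter P? xs) * -1ℤ ^ length (filter P? ys)
    ≡⟨ cong₂ _*_ (trans (cong (λ zs → -1ℤ ^ length (filter P? zs)) (List.map-tabulate g (f zero ,_)))
                        (-1^length-filter-tabulate P? (λ j → f zero , g j)))
                 (-1^length-filter-cartesianProduct P? (f ∘ suc) g) ⟩
  product (λ i → product λ j → factor (P? (f i , g j)))         ∎
  where
  open ≡-Reasoning
  xs = List.map (f zero ,_) (List.tabulate g)
  ys = cartesianProduct (List.tabulate (f ∘ suc)) (List.tabulate g)

product-below : ∀ {n} (p : Fin n) → product (λ (k : Fin n) → factor (k Fin.<? p)) ≡ -1ℤ ^ toℕ p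
product-below {suc n} zero = trans
  (Product.sum-cong-≗ (λ (k : Fin (suc n)) → factor-no (λ ()) (k Fin.<? zero {n})))
  (Product.sum-replicate-zero (suc n))
product-below {suc n} (suc p) = cong (-1ℤ *_) (trans
  (Product.sum-cong-≗ λ (k : Fin n) → factor-cong ℕ.s<s⁻¹ ℕ.s<s (suc k Fin.<? suc p) (k Fin.<? p))
  (product-below p))

punchIn-cancel-< : ∀ {n} p (i j : Fin n) → punchIn p i Fin.< punchIn p j → i Fin.< j
punchIn-cancel-< p i j lt = ℕ.≰⇒> λ j≤i → ℕ.<⇒≱ lt (Fin.punchIn-mono-≤ p j i j≤i)

punchIn-mono-< : ∀ {n} p (i j : Fin n) → i Fin.< j → punchIn p i Fin.< punchIn p j
punchIn-mono-< p i j lt = ℕ.≰⇒> λ j≤i → ℕ.<⇒≱ lt (Fin.punchIn-cancel-≤ p j i j≤i)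

*-cong₂ : ∀ {a b c d x y z w} → a ≡ x → b ≡ y → c ≡ z → d ≡ w → x * y ≡ z * w → a * b ≡ c * d
*-cong₂ refl refl refl refl eq = eq

inversion? : ∀ {m} (π : Permutation′ m) (i j : Fin m) →
             Dec (i Fin.< j × π ⟨$⟩ʳ j Fin.< π ⟨$⟩ʳ i)
inversion? π i j = (i Fin.<? j) ×-dec ((π ⟨$⟩ʳ j) Fin.<? (π ⟨$⟩ʳ i))

inversion : ∀ {m} → Permutation′ m → Fin m → Fin m → ℤ
inversion π i j = factor (inversion? π i j)

permSign-product : ∀ {m} (π : Permutation′ m) →
                   permSign π ≡ product λ i → product λ j → inversion π i j
permSign-product {m} π = -1^length-filter-cartesianProduct
  (λ (i , j) → inversion? π i j) {m} {m} id id

permSign-sign : ∀ {m} (π : Permutation′ m) → IsSign (permSign π)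
permSign-sign π = subst IsSign (sym (permSign-product π))
  (product-sign _ λ i → product-sign _ λ j → factor-sign (inversion? π i j))

permSign-cong : ∀ {m} (π ρ : Permutation′ m) → π Perm.≈ ρ → permSign π ≡ permSign ρ
permSign-cong π ρ π≈ρ = begin
  permSign π                                     ≡⟨ permSign-product π ⟩
  product (λ i → product λ j → inversion π i j)  ≡⟨ Product.sum-cong-≗ (λ i → Product.sum-cong-≗ λ j → eq i j) ⟩
  product (λ i → product λ j → inversion ρ i j)  ≡⟨ permSign-product ρ ⟨
  permSign ρ                                     ∎
  where
  open ≡-Reasoning
  eq : ∀ i j → inversion π i j ≡ inversion ρ i j
  eq i j rewrite π≈ρ i | π≈ρ j = refl

module _ {m} (π : Permutation′ m) where

  -- The unordered pair of `k` and `p` is inverted precisely when one of `k < p` and `π k < π p`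
  -- holds and the other fails, so its sign is the product of the two factors. For `k = p` both
  -- comparisons fail.
  inversion-pair : ∀ p k →
    inversion π p k * inversion π k p ≡ factor (k Fin.<? p) * factor ((π ⟨$⟩ʳ k) Fin.<? (π ⟨$⟩ʳ p))
  inversion-pair p k
    with (k Fin.<? p) | (π ⟨$⟩ʳ k) Fin.<? (π ⟨$⟩ʳ p) | inversion? π p k | inversion? π k p | Fin.<-cmp k p
  ... | k? | πk? | p,k? | k,p? | tri≈ ≮ refl _ = *-cong₂
          (factor-no (≮ ∘ proj₁) p,k?) (factor-no (≮ ∘ proj₁) k,p?)
          (factor-no ≮ k?) (factor-no (ℕ.<-irrefl refl) πk?) refl
  ... | k? | πk? | p,k? | k,p? | tri> ≮ _ gt = *-cong₂
          (factor-cong proj₂ (gt ,_) p,k? πk?) (factor-no (≮ ∘ proj₁) k,p?)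
          (factor-no ≮ k?) refl (ℤ.*-comm (factor πk?) 1ℤ)
  ... | k? | πk? | p,k? | k,p? | tri< lt _ ≯ with Fin.<-cmp (π ⟨$⟩ʳ k) (π ⟨$⟩ʳ p)
  ...   | tri< lt′ _ ≯′ = *-cong₂
            (factor-no (≯ ∘ proj₁) p,k?) (factor-no (≯′ ∘ proj₂) k,p?)
            (factor-yes lt k?) (factor-yes lt′ πk?) refl
  ...   | tri≈ _ eq _ = contradiction (Injection.injective (↔⇒↣ π) eq) (ℕ.<⇒≢ lt ∘ cong toℕ)
  ...   | tri> ≮′ _ gt′ = *-cong₂
            (factor-no (≯ ∘ proj₁) p,k?) (factor-yes (lt , gt′) k,p?)
            (factor-yes lt k?) (factor-no ≮′ πk?) refl

  -- The second factor depends on `k` only through `π k`, so permuting its product by `π` makes it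
  -- count the indices below `π p`.
  product-inversion-pairs : ∀ p →
    product (λ k → inversion π p k * inversion π k p) ≡ -1ℤ ^ toℕ p * -1ℤ ^ toℕ (π ⟨$⟩ʳ p)
  product-inversion-pairs p = begin
    product (λ k → inversion π p k * inversion π k p)
      ≡⟨ Product.sum-cong-≗ (inversion-pair p) ⟩
    product (λ (k : Fin m) → factor (k Fin.<? p) * factor ((π ⟨$⟩ʳ k) Fin.<? (π ⟨$⟩ʳ p)))
      ≡⟨ Product.∑-distrib-+ {m} (λ (k : Fin m) → factor (k Fin.<? p)) (λ k → factor ((π ⟨$⟩ʳ k) Fin.<? (π ⟨$⟩ʳ p))) ⟩
    product (λ (k : Fin m) → factor (k Fin.<? p)) * product (λ k → factor ((π ⟨$⟩ʳ k) Fin.<? (π ⟨$⟩ʳ p)))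
      ≡⟨ cong (product (λ (k : Fin m) → factor (k Fin.<? p)) *_)
           (Product.sum-permute (λ (k : Fin m) → factor (k Fin.<? (π ⟨$⟩ʳ p))) π) ⟨
    product (λ (k : Fin m) → factor (k Fin.<? p)) * product (λ (k : Fin m) → factor (k Fin.<? (π ⟨$⟩ʳ p)))
      ≡⟨ cong₂ _*_ (product-below p) (product-below (π ⟨$⟩ʳ p)) ⟩
    -1ℤ ^ toℕ p * -1ℤ ^ toℕ (π ⟨$⟩ʳ p)
      ∎
    where open ≡-Reasoning

-- Splitting off the row and the column of p in the double product over pairs leaves the
-- inversions of remove p π; the pairs involving p contribute ∏ₖ [k < p] [π k < π p].
permSign-remove : ∀ {m} (π : Permutation′ (suc m)) p →
  permSign π ≡ (-1ℤ ^ toℕ p * -1ℤ ^ toℕ (π ⟨$⟩ʳ p)) * permSign (Perm.remove p π)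
permSign-remove {m} π p = begin
  permSign π
    ≡⟨ permSign-product π ⟩
  product (λ i → product (s i))
    ≡⟨ Product.sum-remove {i = p} (λ i → product (s i)) ⟩
  product (s p) * product (λ i → product (s (↑ i)))
    ≡⟨ cong (product (s p) *_) (Product.sum-cong-≗ λ i → Product.sum-remove {i = p} (s (↑ i))) ⟩
  product (s p) * product (λ i → s (↑ i) p * product (λ j → s (↑ i) (↑ j)))
    ≡⟨ cong (product (s p) *_) (Product.∑-distrib-+ {m} (λ i → s (↑ i) p) (λ i → product (λ j → s (↑ i) (↑ j)))) ⟩
  product (s p) * (product (λ i → s (↑ i) p) * product (λ i → product (λ j → s (↑ i) (↑ j))))
    ≡⟨ ℤ.*-assoc (product (s p)) (product (λ i → s (↑ i) p)) (product (λ i → product (λ j → s (↑ i) (↑ j)))) ⟨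
  product (s p) * product (λ i → s (↑ i) p) * product (λ i → product (λ j → s (↑ i) (↑ j)))
    ≡⟨ cong₂ _*_ (cong (product (s p) *_) through-p)
         (trans (Product.sum-cong-≗ λ i → Product.sum-cong-≗ (minor i)) (sym (permSign-product (Perm.remove p π)))) ⟩
  product (s p) * product (λ i → s i p) * permSign (Perm.remove p π)
    ≡⟨ cong (_* permSign (Perm.remove p π))
         (trans (sym (Product.∑-distrib-+ {suc m} (s p) (λ i → s i p))) (product-inversion-pairs π p)) ⟩
  (-1ℤ ^ toℕ p * -1ℤ ^ toℕ (π ⟨$⟩ʳ p)) * permSign (Perm.remove p π)
    ∎
  where
  open ≡-Reasoning
  s = inversion π
  ↑ = punchIn p
  -- The diagonal factor at `p` is 1, so it can be restored and the column of `p` becomes a full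
  -- product, ready to be paired with the row.
  through-p : product (λ i → s (↑ i) p) ≡ product (λ i → s i p)
  through-p = sym (trans (Product.sum-remove {i = p} (λ i → s i p))
    (trans (cong (_* product (λ i → s (↑ i) p)) (factor-no (ℕ.<-irrefl refl ∘ proj₁) (inversion? π p p)))
           (ℤ.*-identityˡ (product (λ i → s (↑ i) p)))))
  minor : ∀ i j → s (↑ i) (↑ j) ≡ inversion (Perm.remove p π) i j
  minor i j = factor-cong
    (λ (x , y) → punchIn-cancel-< p i j x , punchIn-cancel-< (π ⟨$⟩ʳ p) _ _
      (subst₂ Fin._<_ (Perm.punchIn-permute π p j) (Perm.punchIn-permute π p i) y))
    (λ (x , y) → punchIn-mono-< p i j x ,
      subst₂ Fin._<_ (sym (Perm.punchIn-permute π p j)) (sym (Perm.punchIn-permute π p i))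
        (punchIn-mono-< (π ⟨$⟩ʳ p) _ _ y))
    (inversion? π (↑ i) (↑ j)) (inversion? (Perm.remove p π) i j)

-- Induction by removing a point. `ρ` must lose `π zero`, not `zero`, so that removal commutes with
-- composition. The sign of that intermediate point then occurs once for `π` and once for `ρ`, and
-- its square is 1.
permSign-∘ : ∀ {m} (π ρ : Permutation′ m) → permSign (π ∘ₚ ρ) ≡ permSign π * permSign ρ
permSign-∘ {zero}  π ρ = refl
permSign-∘ {suc m} π ρ = begin
  permSign (π ∘ₚ ρ)
    ≡⟨ permSign-remove (π ∘ₚ ρ) zero ⟩
  1ℤ * c * permSign (Perm.remove zero (π ∘ₚ ρ))
    ≡⟨ cong (1ℤ * c *_) (permSign-cong (Perm.remove zero (π ∘ₚ ρ)) (π₀ ∘ₚ ρ₀) remove-∘) ⟩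
  1ℤ * c * permSign (π₀ ∘ₚ ρ₀)
    ≡⟨ cong (1ℤ * c *_) (permSign-∘ π₀ ρ₀) ⟩
  1ℤ * c * (permSign π₀ * permSign ρ₀)
    ≡⟨ cong (_* (permSign π₀ * permSign ρ₀)) (cong (_* c) (sym (sign-square (-1^-sign (toℕ (π ⟨$⟩ʳ zero)))))) ⟩
  b * b * c * (permSign π₀ * permSign ρ₀)
    ≡⟨ rearrange b c (permSign π₀) (permSign ρ₀) ⟩
  (1ℤ * b * permSign π₀) * (b * c * permSign ρ₀)
    ≡⟨ cong₂ _*_ (permSign-remove π zero) (permSign-remove ρ (π ⟨$⟩ʳ zero)) ⟨
  permSign π * permSign ρ
    ∎
  where
  open ≡-Reasoning
  b = -1ℤ ^ toℕ (π ⟨$⟩ʳ zero)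
  c = -1ℤ ^ toℕ (ρ ⟨$⟩ʳ (π ⟨$⟩ʳ zero))
  π₀ = Perm.remove zero π
  ρ₀ = Perm.remove (π ⟨$⟩ʳ zero) ρ
  rearrange : ∀ b c x y → b * b * c * (x * y) ≡ (1ℤ * b * x) * (b * c * y)
  rearrange = solve-∀
  remove-∘ : Perm.remove zero (π ∘ₚ ρ) Perm.≈ (π₀ ∘ₚ ρ₀)
  remove-∘ i = Fin.punchIn-injective (ρ ⟨$⟩ʳ (π ⟨$⟩ʳ zero)) _ _ (begin
    punchIn (ρ ⟨$⟩ʳ (π ⟨$⟩ʳ zero)) (Perm.remove zero (π ∘ₚ ρ) ⟨$⟩ʳ i)  ≡⟨ Perm.punchIn-permute (π ∘ₚ ρ) zero i ⟨
    ρ ⟨$⟩ʳ (π ⟨$⟩ʳ suc i)                                              ≡⟨ cong (ρ ⟨$⟩ʳ_) (Perm.punchIn-permute π zero i) ⟩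
    ρ ⟨$⟩ʳ (punchIn (π ⟨$⟩ʳ zero) (π₀ ⟨$⟩ʳ i))                         ≡⟨ Perm.punchIn-permute ρ (π ⟨$⟩ʳ zero) (π₀ ⟨$⟩ʳ i) ⟩
    punchIn (ρ ⟨$⟩ʳ (π ⟨$⟩ʳ zero)) (ρ₀ ⟨$⟩ʳ (π₀ ⟨$⟩ʳ i))               ∎)

-- Column operations and alternating forms

sum-null : ∀ {n} (f : Fin n → ℤ) → (∀ i → f i ≡ 0ℤ) → sum f ≡ 0ℤ
sum-null {n} f f≗0 = trans (Addition.sum-cong-≗ f≗0) (Addition.sum-replicate-zero n)

V : ℕ → Set
V n = Fin n → ℤ

infixl 6 _+[_]_

_+[_]_ : ∀ {n} → V n → ℤ → V n → V n
(u +[ t ] v) i = u i + t * v i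

sum-+[] : ∀ {n} (u v : V n) t → sum (u +[ t ] v) ≡ sum u + t * sum v
sum-+[] u v t = trans (Addition.∑-distrib-+ u (λ i → t * v i))
  (cong (_+_ (sum u)) (sym (Addition.*-distribˡ-sum t v)))

-- A vector lists the columns of a matrix.
infix 4 _↝_

data _↝_ {n} : ∀ {k} → Vec (V n) k → Vec (V n) k → Set where
  done  : ∀ {k} {c : Vec (V n) k} → c ↝ c
  fst+  : ∀ {k u v} {c : Vec (V n) k} t → u ∷ v ∷ c ↝ (u +[ t ] v) ∷ v ∷ c
  snd+  : ∀ {k u v} {c : Vec (V n) k} t → u ∷ v ∷ c ↝ u ∷ (v +[ t ] u) ∷ c
  keep  : ∀ {k u} {c c′ : Vec (V n) k} → c ↝ c′ → u ∷ c ↝ u ∷ c′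
  _⨾_   : ∀ {k} {c c′ c″ : Vec (V n) k} → c ↝ c′ → c′ ↝ c″ → c ↝ c″

module _ {n : ℕ} where

  Linear : ∀ {k} → (Vec (V n) (suc k) → ℤ) → Set
  Linear f = ∀ u t v c → f ((u +[ t ] v) ∷ c) ≡ f (u ∷ c) + t * f (v ∷ c)

  Kills : ∀ {k} → V n → (Vec (V n) k → ℤ) → Set
  Kills {zero}  u f = ⊤
  Kills {suc k} u f = ∀ c → f (u ∷ c) ≡ 0ℤ

  -- Multilinear, and zero whenever two adjacent columns coincide. Adjacent columns suffice because
  -- `_↝_` shears only neighbours, and recursion on the leading column reaches every position.
  Alternating : ∀ {k} → (Vec (V n) k → ℤ) → Set
  Alternating {zero}  f = ⊤
  Alternating {suc k} f = Linear f × ∀ u → Kills u (f ∘ (u ∷_)) × Alternating (f ∘ (u ∷_))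

  -- Each shear adds a multiple of a term with two equal neighbouring columns, which is zero. Swaps
  -- and rescalings are no constructors of `_↝_`, hence equality on the nose.
  alternating-↝ : ∀ {k} (f : Vec (V n) k → ℤ) → Alternating f → ∀ {c c′} → c ↝ c′ → f c ≡ f c′
  alternating-↝ f alt done = refl
  alternating-↝ f (lin , alt) (fst+ {u = u} {v} {c} t) = sym (begin
    f ((u +[ t ] v) ∷ v ∷ c)            ≡⟨ lin u t v (v ∷ c) ⟩
    f (u ∷ v ∷ c) + t * f (v ∷ v ∷ c)   ≡⟨ cong (λ z → f (u ∷ v ∷ c) + t * z) (proj₁ (alt v) c) ⟩
    f (u ∷ v ∷ c) + t * 0ℤ              ≡⟨ absorb (f (u ∷ v ∷ c)) t ⟩
    f (u ∷ v ∷ c)                       ∎)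
    where
    open ≡-Reasoning
    absorb : ∀ x t → x + t * 0ℤ ≡ x
    absorb = solve-∀
  alternating-↝ f (lin , alt) (snd+ {u = u} {v} {c} t) = sym (begin
    f (u ∷ (v +[ t ] u) ∷ c)            ≡⟨ proj₁ (proj₂ (alt u)) v t u c ⟩
    f (u ∷ v ∷ c) + t * f (u ∷ u ∷ c)   ≡⟨ cong (λ z → f (u ∷ v ∷ c) + t * z) (proj₁ (alt u) c) ⟩
    f (u ∷ v ∷ c) + t * 0ℤ              ≡⟨ absorb (f (u ∷ v ∷ c)) t ⟩
    f (u ∷ v ∷ c)                       ∎)
    where
    open ≡-Reasoning
    absorb : ∀ x t → x + t * 0ℤ ≡ x
    absorb = solve-∀
  alternating-↝ f (lin , alt) (keep {u = u} s) = alternating-↝ (f ∘ (u ∷_)) (proj₂ (alt u)) s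
  alternating-↝ f alt (s ⨾ s′) = trans (alternating-↝ f alt s) (alternating-↝ f alt s′)

  -- `a * f c - g c` is the shape that `laplace` takes once its first column is fixed.
  alternating-combine : ∀ {k} a (f g : Vec (V n) k → ℤ) → Alternating f → Alternating g →
                        Alternating (λ c → a * f c - g c)
  alternating-combine {zero} a f g _ _ = tt
  alternating-combine {suc k} a f g (lin-f , alt-f) (lin-g , alt-g) =
    (λ u t v c → trans (cong₂ (λ x y → a * x - y) (lin-f u t v c) (lin-g u t v c))
                       (regroup a t (f (u ∷ c)) (f (v ∷ c)) (g (u ∷ c)) (g (v ∷ c)))) ,
    λ u → kills (f ∘ (u ∷_)) (g ∘ (u ∷_)) (proj₁ (alt-f u)) (proj₁ (alt-g u)) ,
          alternating-combine a (f ∘ (u ∷_)) (g ∘ (u ∷_)) (proj₂ (alt-f u)) (proj₂ (alt-g u))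
    where
    regroup : ∀ a t x x′ y y′ → a * (x + t * x′) - (y + t * y′) ≡ (a * x - y) + t * (a * x′ - y′)
    regroup = solve-∀
    cancel : ∀ a → a * 0ℤ - 0ℤ ≡ 0ℤ
    cancel = solve-∀
    kills : ∀ {k u} (f g : Vec (V n) k → ℤ) → Kills u f → Kills u g → Kills u (λ c → a * f c - g c)
    kills {zero}  f g _ _ = tt
    kills {suc k} f g p q c = trans (cong₂ (λ x y → a * x - y) (p c) (q c)) (cancel a)

  -- The expansion along a row is defined without indices, so that being alternating is proved by
  -- recursion on the list of columns: g and laplace ℓ (g ∘ (u ∷_)) are alternating again.
  laplace : ∀ {k} → (V n → ℤ) → (Vec (V n) k → ℤ) → Vec (V n) (suc k) → ℤ
  laplace {zero}  ℓ g (u ∷ c) = ℓ u * g c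
  laplace {suc k} ℓ g (u ∷ c) = ℓ u * g c - laplace ℓ (g ∘ (u ∷_)) c

  module _ (ℓ : V n → ℤ) where

    -- Past the first term of the expansion, the first column sits inside the form `g ∘ (u ∷_)`.
    -- Linearity in that column thus becomes linearity in the form.
    laplace-linear : ∀ {k} t (f g h : Vec (V n) k → ℤ) → (∀ c → f c ≡ g c + t * h c) →
                     ∀ c → laplace ℓ f c ≡ laplace ℓ g c + t * laplace ℓ h c
    laplace-linear {zero}  t f g h f≗ (u ∷ c) =
      trans (cong (ℓ u *_) (f≗ c)) (regroup (ℓ u) t (g c) (h c))
      where
      regroup : ∀ a t x y → a * (x + t * y) ≡ a * x + t * (a * y)
      regroup = solve-∀
    laplace-linear {suc k} t f g h f≗ (u ∷ c) = trans
      (cong₂ (λ x y → ℓ u * x - y) (f≗ c)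
        (laplace-linear t (f ∘ (u ∷_)) (g ∘ (u ∷_)) (h ∘ (u ∷_)) (f≗ ∘ (u ∷_)) c))
      (regroup (ℓ u) t (g c) (h c) (laplace ℓ (g ∘ (u ∷_)) c) (laplace ℓ (h ∘ (u ∷_)) c))
      where
      regroup : ∀ a t x y z w → a * (x + t * y) - (z + t * w) ≡ (a * x - z) + t * (a * y - w)
      regroup = solve-∀

    laplace-null : ∀ {k} (g : Vec (V n) k → ℤ) → (∀ c → g c ≡ 0ℤ) → ∀ c → laplace ℓ g c ≡ 0ℤ
    laplace-null {zero}  g g≗0 (u ∷ c) = trans (cong (ℓ u *_) (g≗0 c)) (ℤ.*-zeroʳ (ℓ u))
    laplace-null {suc k} g g≗0 (u ∷ c) = trans
      (cong₂ (λ x y → ℓ u * x - y) (g≗0 c) (laplace-null (g ∘ (u ∷_)) (g≗0 ∘ (u ∷_)) c)) (cancel (ℓ u))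
      where
      cancel : ∀ a → a * 0ℤ - 0ℤ ≡ 0ℤ
      cancel = solve-∀

    laplace-kernel : ∀ {k} (g : Vec (V n) k → ℤ) {c} → All (λ v → ℓ v ≡ 0ℤ) c → laplace ℓ g c ≡ 0ℤ
    laplace-kernel {zero}  g {u ∷ c} (p ∷ _)  = trans (cong (_* g c) p) (ℤ.*-zeroˡ (g c))
    laplace-kernel {suc k} g {u ∷ c} (p ∷ ps) = trans
      (cong₂ (λ x y → x * g c - y) p (laplace-kernel (g ∘ (u ∷_)) ps)) (cancel (g c))
      where
      cancel : ∀ a → 0ℤ * a - 0ℤ ≡ 0ℤ
      cancel = solve-∀

    module _ (ℓ-linear : ∀ u t v → ℓ (u +[ t ] v) ≡ ℓ u + t * ℓ v) where

      laplace-alternating : ∀ {k} (g : Vec (V n) k → ℤ) → Alternating g → Alternating (laplace ℓ g)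
      laplace-alternating {zero} g alt =
        (λ { u t v [] → trans (cong (_* g []) (ℓ-linear u t v)) (regroup (ℓ u) t (ℓ v) (g [])) }) ,
        λ _ → tt , tt
        where
        regroup : ∀ a t b x → (a + t * b) * x ≡ a * x + t * (b * x)
        regroup = solve-∀
      laplace-alternating {suc k} g (lin , alt) =
        (λ u t v c → trans
          (cong₂ (λ x y → x * g c - y) (ℓ-linear u t v)
            (laplace-linear t (g ∘ ((u +[ t ] v) ∷_)) (g ∘ (u ∷_)) (g ∘ (v ∷_)) (lin u t v) c))
          (regroup (ℓ u) t (ℓ v) (g c) (laplace ℓ (g ∘ (u ∷_)) c) (laplace ℓ (g ∘ (v ∷_)) c))) ,
        λ u → kills g u (proj₁ (alt u)) ,
              alternating-combine (ℓ u) g (laplace ℓ (g ∘ (u ∷_))) (lin , alt)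
                (laplace-alternating (g ∘ (u ∷_)) (proj₂ (alt u)))
        where
        regroup : ∀ a t b x y z → (a + t * b) * x - (y + t * z) ≡ (a * x - y) + t * (b * x - z)
        regroup = solve-∀
        cancel₁ : ∀ a x → a * x - a * x ≡ 0ℤ
        cancel₁ = solve-∀
        cancel₂ : ∀ a x → a * x - (a * x - 0ℤ) ≡ 0ℤ
        cancel₂ = solve-∀
        -- With two equal leading columns the first two terms of the expansion cancel, and what
        -- remains expands the form `g (u ∷ u ∷ _)`, which is zero.
        kills : ∀ {k} (g : Vec (V n) (suc k) → ℤ) u → Kills u (g ∘ (u ∷_)) → Kills u (laplace ℓ g ∘ (u ∷_))
        kills {zero}  g u p [] = cancel₁ (ℓ u) (g (u ∷ []))
        kills {suc k} g u p c = trans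
          (cong (λ z → ℓ u * g (u ∷ c) - (ℓ u * g (u ∷ c) - z)) (laplace-null (λ c → g (u ∷ u ∷ c)) p c))
          (cancel₂ (ℓ u) (g (u ∷ c)))

dropRow : ∀ {n k} → Vec (V (suc n)) k → Vec (V n) k
dropRow = Vec.map (_∘ suc)

alternating-dropRow : ∀ {n k} (f : Vec (V n) k → ℤ) → Alternating f → Alternating (f ∘ dropRow)
alternating-dropRow {k = zero}  f _ = tt
alternating-dropRow {k = suc k} f (lin , alt) =
  (λ u t v c → lin (u ∘ suc) t (v ∘ suc) (dropRow c)) ,
  λ u → kills (f ∘ ((u ∘ suc) ∷_)) u (proj₁ (alt (u ∘ suc))) ,
        alternating-dropRow (f ∘ ((u ∘ suc) ∷_)) (proj₂ (alt (u ∘ suc)))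
  where
  kills : ∀ {n k} (f : Vec (V n) k → ℤ) u → Kills (u ∘ suc) f → Kills u (f ∘ dropRow)
  kills {k = zero}  f u _ = tt
  kills {k = suc k} f u p c = p (dropRow c)

colDet : ∀ {n} → Vec (V n) n → ℤ
colDet {zero}  _ = 1ℤ
colDet {suc n} = laplace (λ v → v zero) (colDet ∘ dropRow)

colDet-alternating : ∀ {n} → Alternating (colDet {n})
colDet-alternating {zero}  = tt
colDet-alternating {suc n} = laplace-alternating (λ v → v zero) (λ _ _ _ → refl) (colDet ∘ dropRow)
  (alternating-dropRow colDet (colDet-alternating {n}))

colDet-∷ : ∀ {n v} {c : Vec (V (suc n)) n} → All (λ w → w zero ≡ 0ℤ) c →
           colDet (v ∷ c) ≡ v zero * colDet (dropRow c)
colDet-∷ {zero}  {v} {[]} []  = refl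
colDet-∷ {suc n} {v} {c}  null = trans
  (cong (λ z → v zero * colDet (dropRow c) - z)
        (laplace-kernel (λ w → w zero) (λ c′ → colDet (dropRow (v ∷ c′))) null))
  (ℤ.+-identityʳ (v zero * colDet (dropRow c)))

-- The index of the column lattice

-- The closure law `shear` mirrors the column operations, so that membership of all columns is
-- invariant under `_↝_`. It is applied to the column span, to carry representatives along, and to
-- the annihilator of a vector, to carry row relations along.
record Submodule n : Set₁ where
  field
    Member : V n → Set
    resp   : ∀ {u v} → u ≗ v → Member u → Member v
    0∈     : Member (λ _ → 0ℤ)
    shear  : ∀ {u v} t → Member u → Member v → Member (u +[ t ] v)

  unshear : ∀ {u v} t → Member (u +[ t ] v) → Member v → Member u
  unshear {u} {v} t p q = resp (λ i → cancel (u i) t (v i)) (shear (- t) p q)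
    where
    cancel : ∀ x t y → x + t * y + - t * y ≡ x
    cancel = solve-∀

open Submodule using (Member)

module _ {n} (W : Submodule n) where
  open Submodule W using (resp; 0∈; shear; unshear)

  ↝-member : ∀ {k} {c c′ : Vec (V n) k} → c ↝ c′ → All (Member W) c → All (Member W) c′
  ↝-member done     ps           = ps
  ↝-member (fst+ t) (p ∷ q ∷ ps) = shear t p q ∷ q ∷ ps
  ↝-member (snd+ t) (p ∷ q ∷ ps) = p ∷ shear t q p ∷ ps
  ↝-member (keep s) (p ∷ ps)     = p ∷ ↝-member s ps
  ↝-member (s ⨾ s′) ps           = ↝-member s′ (↝-member s ps)

  ↜-member : ∀ {k} {c c′ : Vec (V n) k} → c ↝ c′ → All (Member W) c′ → All (Member W) c
  ↜-member done     ps           = ps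
  ↜-member (fst+ t) (p ∷ q ∷ ps) = unshear t p q ∷ q ∷ ps
  ↜-member (snd+ t) (p ∷ q ∷ ps) = p ∷ unshear t q p ∷ ps
  ↜-member (keep s) (p ∷ ps)     = p ∷ ↜-member s ps
  ↜-member (s ⨾ s′) ps           = ↜-member s (↜-member s′ ps)

dot : ∀ {n} → V n → V n → ℤ
dot x v = sum λ i → x i * v i

annihilator : ∀ {n} → V n → Submodule n
annihilator x = record
  { Member = λ v → dot x v ≡ 0ℤ
  ; resp   = λ u≗v p → trans (sym (Addition.sum-cong-≗ λ i → cong (x i *_) (u≗v i))) p
  ; 0∈     = sum-null (λ i → x i * 0ℤ) (λ i → ℤ.*-zeroʳ (x i))
  ; shear  = λ {u} {v} t p q → begin
      sum (λ i → x i * (u i + t * v i))             ≡⟨ Addition.sum-cong-≗ (λ i → expand (x i) (u i) t (v i)) ⟩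
      sum ((λ i → x i * u i) +[ t ] (λ i → x i * v i)) ≡⟨ sum-+[] (λ i → x i * u i) (λ i → x i * v i) t ⟩
      dot x u + t * dot x v                         ≡⟨ cong₂ (λ y z → y + t * z) p q ⟩
      0ℤ + t * 0ℤ                                   ≡⟨ cong (_+_ 0ℤ) (ℤ.*-zeroʳ t) ⟩
      0ℤ                                            ∎
  }
  where
  open ≡-Reasoning
  expand : ∀ x u t v → x * (u + t * v) ≡ x * u + t * (x * v)
  expand = solve-∀

lincomb : ∀ {n k} → V k → Vec (V n) k → V n
lincomb x c i = sum λ j → x j * lookup c j i

lincomb-null : ∀ {n k} (x : V k) (c : Vec (V n) k) {i} → All (λ v → v i ≡ 0ℤ) c → lincomb x c i ≡ 0ℤ
lincomb-null x c {i} ps = sum-null (λ j → x j * lookup c j i)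
  (λ j → trans (cong (x j *_) (All.lookup⁺ ps j)) (ℤ.*-zeroʳ (x j)))

lincomb-dropRow : ∀ {n k} (x : V k) (c : Vec (V (suc n)) k) i → lincomb x (dropRow c) i ≡ lincomb x c (suc i)
lincomb-dropRow x c i = Addition.sum-cong-≗ λ j → cong (λ v → x j * v i) (Vec.lookup-map j (_∘ suc) c)

InSpan : ∀ {n k} → Vec (V n) k → V n → Set
InSpan c v = ∃[ x ] lincomb x c ≗ v

span : ∀ {n k} → Vec (V n) k → Submodule n
span c = record
  { Member = InSpan c
  ; resp   = λ u≗v (x , p) → x , λ i → trans (p i) (u≗v i)
  ; 0∈     = (λ _ → 0ℤ) , λ i → sum-null (λ j → 0ℤ * lookup c j i) (λ j → ℤ.*-zeroˡ (lookup c j i))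
  ; shear  = λ {u} {v} t (x , p) (y , q) → x +[ t ] y , λ i → begin
      sum (λ j → (x j + t * y j) * lookup c j i)
        ≡⟨ Addition.sum-cong-≗ (λ j → expand (x j) t (y j) (lookup c j i)) ⟩
      sum ((λ j → x j * lookup c j i) +[ t ] (λ j → y j * lookup c j i))
        ≡⟨ sum-+[] (λ j → x j * lookup c j i) (λ j → y j * lookup c j i) t ⟩
      lincomb x c i + t * lincomb y c i
        ≡⟨ cong₂ (λ y z → y + t * z) (p i) (q i) ⟩
      u i + t * v i
        ∎
  }
  where
  open ≡-Reasoning
  expand : ∀ x t y w → (x + t * y) * w ≡ x * w + t * (y * w)
  expand = solve-∀

span-generators : ∀ {n k} (c : Vec (V n) k) → All (InSpan c) c
span-generators []      = []
span-generators {n} (v ∷ c) =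
  (1ℤ Vector.∷ (λ _ → 0ℤ) , λ i → trans
    (cong (_+_ (1ℤ * v i)) (sum-null (λ j → 0ℤ * lookup c j i) (λ j → ℤ.*-zeroˡ (lookup c j i))))
    (one (v i))) ∷
  All.map (λ {w} → weaken {w}) (span-generators c)
  where
  one : ∀ x → 1ℤ * x + 0ℤ ≡ x
  one = solve-∀
  weaken : ∀ {w} → InSpan c w → InSpan (v ∷ c) w
  weaken {w} (x , p) = 0ℤ Vector.∷ x , λ i → trans
    (cong₂ _+_ (ℤ.*-zeroˡ (v i)) (p i)) (ℤ.+-identityˡ (w i))

span-least : ∀ {n k} (W : Submodule n) (c : Vec (V n) k) → All (Member W) c →
             ∀ v → InSpan c v → Member W v
span-least W []      _        v (x , p) = Submodule.resp W p (Submodule.0∈ W)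
span-least W (u ∷ c) (q ∷ qs) v (x , p) = Submodule.resp W
  (λ i → trans (ℤ.+-comm (lincomb (x ∘ suc) c i) (x zero * u i)) (p i))
  (Submodule.shear W (x zero) (span-least W c qs (lincomb (x ∘ suc) c) (x ∘ suc , λ _ → refl)) q)

-- The generators of `c′` lie in their own span; undoing the operations inside that submodule puts
-- the columns of `c` there too.
span-↝ : ∀ {n k} {c c′ : Vec (V n) k} → c ↝ c′ → ∀ v → InSpan c v → InSpan c′ v
span-↝ {c = c} {c′} s = span-least (span c′) c (↜-member (span c′) s (span-generators c′))

span-↜ : ∀ {n k} {c c′ : Vec (V n) k} → c ↝ c′ → ∀ v → InSpan c′ v → InSpan c v
span-↜ {c = c} {c′} s = span-least (span c) c′ (↝-member (span c) s (span-generators c))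

remainder : ∀ a b → b ≢ 0ℤ → ∃[ t ] ∣ a + t * b ∣ ℕ.< ∣ b ∣
remainder a b b≢0 = - (a ℤ./ b) ,
  subst (λ z → ∣ z ∣ ℕ.< ∣ b ∣) (sym eq) (ℤ.n%d<d a b)
  where
  instance _ = ≢-nonZero b≢0
  cancel : ∀ r q b → r + q * b + - q * b ≡ r
  cancel = solve-∀
  eq : a + - (a ℤ./ b) * b ≡ + (a ℤ.% b)
  eq = trans (cong (λ z → z + - (a ℤ./ b) * b) (ℤ.a≡a%n+[a/n]*n a b)) (cancel (+ (a ℤ.% b)) (a ℤ./ b) b)

module _ {n : ℕ} where

  -- The Euclidean algorithm on the top entries, without swaps: a round reduces `u` modulo `v` and
  -- then `v` modulo the new `u`, so the top entry of `v` strictly shrinks in absolute value.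
  euclid : ∀ {k} u v (c : Vec (V (suc n)) k) → Acc ℕ._<_ ∣ v zero ∣ →
           ∃[ u′ ] ∃[ v′ ] u ∷ v ∷ c ↝ u′ ∷ v′ ∷ c × v′ zero ≡ 0ℤ
  euclid u v c (acc rec) with v zero ℤ.≟ 0ℤ
  ... | yes v₀≡0 = u , v , done , v₀≡0
  ... | no  v₀≢0 with remainder (u zero) (v zero) v₀≢0
  ...   | t , lt with u zero + t * v zero ℤ.≟ 0ℤ
  -- Here the zero is in the wrong column. Adding `v` to the first column copies the top entry
  -- there, and subtracting the result from `v` clears it.
  ...     | yes u₀≡0 = _ , _ , fst+ t ⨾ (fst+ 1ℤ ⨾ snd+ -1ℤ) ,
              trans (cong (λ z → v zero + -1ℤ * (z + 1ℤ * v zero)) u₀≡0) (cancel (v zero))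
    where
    cancel : ∀ x → x + -1ℤ * (0ℤ + 1ℤ * x) ≡ 0ℤ
    cancel = solve-∀
  ...     | no  u₀≢0 with remainder (v zero) (u zero + t * v zero) u₀≢0
  ...       | t′ , lt′ with euclid (u +[ t ] v) (v +[ t′ ] (u +[ t ] v)) c (rec (ℕ.<-trans lt′ lt))
  ...         | u′ , v′ , s , eq = u′ , v′ , fst+ t ⨾ (snd+ t′ ⨾ s) , eq

  clearRow : ∀ {k} (c : Vec (V (suc n)) (suc k)) →
             ∃[ v ] ∃[ c′ ] c ↝ v ∷ c′ × All (λ w → w zero ≡ 0ℤ) c′
  clearRow {zero}  (v ∷ []) = v , [] , done , []
  clearRow {suc k} (u ∷ c) with clearRow c
  ... | v , c′ , s , null with euclid u v c′ (<-wellFounded ∣ v zero ∣)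
  ...   | u′ , v′ , s′ , eq = u′ , v′ ∷ c′ , keep s ⨾ s′ , eq ∷ null

-- A system of `N` coset representatives of ℤⁿ modulo the lattice spanned by `c`: the lattice has
-- index `N`.
Transversal : ∀ {n k} → Vec (V n) k → ℕ → Set
Transversal {n} c N = Σ (Fin N → V n) λ e →
  (∀ a b → InSpan c (λ i → e a i - e b i) → a ≡ b) × (∀ (v : V n) → ∃[ a ] InSpan c (λ i → v i - e a i))

transversal-↜ : ∀ {n k N} {c c′ : Vec (V n) k} → c ↝ c′ → Transversal c′ N → Transversal c N
transversal-↜ s (e , inj , surj) =
  e , (λ a b → inj a b ∘ span-↝ s (λ i → e a i - e b i)) ,
  λ v → let a , p = surj v in a , span-↜ s (λ i → v i - e a i) p

RowRelation : ∀ {n k} → Vec (V n) k → Set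
RowRelation {n} c = ∃[ x ] (∃[ i ] x i ≢ 0ℤ) × All (λ v → dot x v ≡ 0ℤ) c

module _ {n k} (v : V (suc n)) (c : Vec (V (suc n)) k) (null : All (λ w → w zero ≡ 0ℤ) c) where

  rowRelation-zero : v zero ≡ 0ℤ → RowRelation (v ∷ c)
  rowRelation-zero v₀≡0 = 1ℤ Vector.∷ (λ _ → 0ℤ) , (zero , λ ()) , All.map (λ {w} → first w) (v₀≡0 ∷ null)
    where
    first : ∀ w → w zero ≡ 0ℤ → dot (1ℤ Vector.∷ (λ _ → 0ℤ)) w ≡ 0ℤ
    first w w₀≡0 = cong₂ (λ x y → 1ℤ * x + y) w₀≡0
      (sum-null (λ i → 0ℤ * w (suc i)) (λ i → ℤ.*-zeroˡ (w (suc i))))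

  rowRelation-suc : v zero ≢ 0ℤ → RowRelation (dropRow c) → RowRelation (v ∷ c)
  rowRelation-suc v₀≢0 (x , (i , xᵢ≢0) , ps) =
    y , (suc i , [ v₀≢0 , xᵢ≢0 ]′ ∘ ℤ.i*j≡0⇒i≡0∨j≡0 (v zero)) ,
    trans (dot-y v) (cancel (dot x (v ∘ suc)) (v zero)) ∷
    All.map (λ {w} (p , q) → kills w p q) (All.zip (null , All.map⁻ ps))
    where
    -- The relation of the minor is scaled by the pivot `v zero`, so that the new leading
    -- coefficient, chosen to kill `v`, is an integer. Below `c` the leading coefficient has no
    -- effect, as the top entries vanish.
    y : V (suc n)
    y = - dot x (v ∘ suc) Vector.∷ (λ i → v zero * x i)
    dot-y : ∀ w → dot y w ≡ - dot x (v ∘ suc) * w zero + v zero * dot x (w ∘ suc)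
    dot-y w = cong (_+_ (- dot x (v ∘ suc) * w zero)) (trans
      (Addition.sum-cong-≗ λ i → ℤ.*-assoc (v zero) (x i) (w (suc i)))
      (sym (Addition.*-distribˡ-sum (v zero) (λ i → x i * w (suc i)))))
    cancel : ∀ s d → - s * d + d * s ≡ 0ℤ
    cancel = solve-∀
    cancel₀ : ∀ s d → - s * 0ℤ + d * 0ℤ ≡ 0ℤ
    cancel₀ = solve-∀
    kills : ∀ w → w zero ≡ 0ℤ → dot x (w ∘ suc) ≡ 0ℤ → dot y w ≡ 0ℤ
    kills w p q = trans (dot-y w)
      (trans (cong₂ (λ a b → - dot x (v ∘ suc) * a + v zero * b) p q) (cancel₀ (dot x (v ∘ suc)) (v zero)))

  module _ {N : ℕ} (v₀≢0 : v zero ≢ 0ℤ) (T : Transversal (dropRow c) N) where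
    private
      d = v zero
      e′ = proj₁ T
      instance _ = ≢-nonZero v₀≢0

      digit : Fin (∣ d ∣ ℕ.* N) → Fin ∣ d ∣
      digit a = proj₁ (Fin.remQuot {∣ d ∣} N a)

      rest : Fin (∣ d ∣ ℕ.* N) → Fin N
      rest a = proj₂ (Fin.remQuot {∣ d ∣} N a)

      -- Mixed radix: the top coordinate is a residue modulo `∣ d ∣`, and the others form a
      -- representative for the minor.
      e : Fin (∣ d ∣ ℕ.* N) → V (suc n)
      e a = + toℕ (digit a) Vector.∷ e′ (rest a)

    -- Two residues differ by less than `∣ d ∣`, so the only multiple of `d` among their differences
    -- is 0.
    coefficient-zero : ∀ x (q q′ : Fin ∣ d ∣) → x * d ≡ + toℕ q - + toℕ q′ → x ≡ 0ℤ
    coefficient-zero x q q′ eq = ℤ.∣i∣≡0⇒i≡0 (ℕ.n<1⇒n≡0 (ℕ.*-cancelʳ-< ∣ d ∣ ∣ x ∣ 1 (begin-strict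
      ∣ x ∣ ℕ.* ∣ d ∣             ≡⟨ ℤ.abs-* x d ⟨
      ∣ x * d ∣                   ≡⟨ cong ∣_∣ (trans eq (ℤ.m-n≡m⊖n (toℕ q) (toℕ q′))) ⟩
      ∣ toℕ q ⊖ toℕ q′ ∣        ≤⟨ ℤ.∣m⊝n∣≤m⊔n (toℕ q) (toℕ q′) ⟩
      toℕ q ℕ.⊔ toℕ q′            <⟨ ℕ.⊔-pres-<m (Fin.toℕ<n q) (Fin.toℕ<n q′) ⟩
      ∣ d ∣                       ≡⟨ ℕ.*-identityˡ ∣ d ∣ ⟨
      1 ℕ.* ∣ d ∣                 ∎)))
      where open ℕ.≤-Reasoning

    lincomb-zero : ∀ x → lincomb x (v ∷ c) zero ≡ x zero * d
    lincomb-zero x = trans (cong (_+_ (x zero * d)) (lincomb-null (x ∘ suc) c null)) (ℤ.+-identityʳ (x zero * d))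

    lincomb-suc : ∀ x i → lincomb x (v ∷ c) (suc i) ≡ x zero * v (suc i) + lincomb (x ∘ suc) (dropRow c) i
    lincomb-suc x i = cong (_+_ (x zero * v (suc i))) (sym (lincomb-dropRow (x ∘ suc) c i))

    transversal-injective : ∀ a b → InSpan (v ∷ c) (λ i → e a i - e b i) → a ≡ b
    transversal-injective a b (x , p) = begin
      a                                                          ≡⟨ Fin.combine-remQuot {∣ d ∣} N a ⟨
      Fin.combine (digit a) (rest a)                             ≡⟨ cong₂ Fin.combine digits rests ⟩
      Fin.combine (digit b) (rest b)                             ≡⟨ Fin.combine-remQuot {∣ d ∣} N b ⟩
      b                                                          ∎
      where
      open ≡-Reasoning
      row₀ : x zero * d ≡ + toℕ (digit a) - + toℕ (digit b)
      row₀ = trans (sym (lincomb-zero x)) (p zero)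
      x₀≡0 : x zero ≡ 0ℤ
      x₀≡0 = coefficient-zero (x zero) (digit a) (digit b) row₀
      digits : digit a ≡ digit b
      digits = Fin.toℕ-injective (ℤ.+-injective (ℤ.i-j≡0⇒i≡j (+ toℕ (digit a)) (+ toℕ (digit b))
        (trans (sym row₀) (cong (_* d) x₀≡0))))
      rests : rest a ≡ rest b
      rests = proj₁ (proj₂ T) (rest a) (rest b) (x ∘ suc , λ i → begin
        lincomb (x ∘ suc) (dropRow c) i                              ≡⟨ ℤ.+-identityˡ (lincomb (x ∘ suc) (dropRow c) i) ⟨
        0ℤ * v (suc i) + lincomb (x ∘ suc) (dropRow c) i
          ≡⟨ cong (λ t → t * v (suc i) + lincomb (x ∘ suc) (dropRow c) i) x₀≡0 ⟨
        x zero * v (suc i) + lincomb (x ∘ suc) (dropRow c) i         ≡⟨ lincomb-suc x i ⟨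
        lincomb x (v ∷ c) (suc i)                                    ≡⟨ p (suc i) ⟩
        e′ (rest a) i - e′ (rest b) i                                ∎)

    transversal-surjective : ∀ (w : V (suc n)) → ∃[ a ] InSpan (v ∷ c) (λ i → w i - e a i)
    transversal-surjective w = a , x , λ
      { zero    → begin
          lincomb x (v ∷ c) zero              ≡⟨ lincomb-zero x ⟩
          t * d                               ≡⟨ shift (w zero) (+ (w zero ℤ.% d)) (t * d) (ℤ.a≡a%n+[a/n]*n (w zero) d) ⟨
          w zero - + (w zero ℤ.% d)           ≡⟨ cong (λ k → w zero - + k) (trans (cong toℕ (cong proj₁ a-digits))
                                                   (Fin.toℕ-fromℕ< (ℤ.n%d<d (w zero) d))) ⟨
          w zero - e a zero                   ∎
      ; (suc i) → begin
          lincomb x (v ∷ c) (suc i)                              ≡⟨ lincomb-suc x i ⟩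
          t * v (suc i) + lincomb y (dropRow c) i                ≡⟨ cong (_+_ (t * v (suc i))) (q i) ⟩
          t * v (suc i) + ((w (suc i) - t * v (suc i)) - e′ b i) ≡⟨ cancel (t * v (suc i)) (w (suc i)) (e′ b i) ⟩
          w (suc i) - e′ b i                                     ≡⟨ cong (λ k → w (suc i) - e′ k i) (cong proj₂ a-digits) ⟨
          w (suc i) - e a (suc i)                                ∎
      }
      where
      open ≡-Reasoning
      t = w zero ℤ./ d
      -- Subtracting `t` copies of `v` leaves the remainder in the top coordinate but also moves the
      -- others, so the minor is asked to represent the corrected vector.
      B = proj₂ (proj₂ T) (λ i → w (suc i) - t * v (suc i))
      b = proj₁ B
      y = proj₁ (proj₂ B)
      q = proj₂ (proj₂ B)
      x : V (suc k)
      x = t Vector.∷ y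
      a = Fin.combine (fromℕ< (ℤ.n%d<d (w zero) d)) b
      a-digits : Fin.remQuot {∣ d ∣} N a ≡ (fromℕ< (ℤ.n%d<d (w zero) d) , b)
      a-digits = Fin.remQuot-combine (fromℕ< (ℤ.n%d<d (w zero) d)) b
      shift : ∀ x r s → x ≡ r + s → x - r ≡ s
      shift x r s refl = drop r s
        where
        drop : ∀ r s → r + s - r ≡ s
        drop = solve-∀
      cancel : ∀ x y z → x + ((y - x) - z) ≡ y - z
      cancel = solve-∀

    transversal-∷ : Transversal (v ∷ c) (∣ d ∣ ℕ.* N)
    transversal-∷ = e , transversal-injective , transversal-surjective

-- Induction on the size through `clearRow`. The outcome for the cleared matrix returns to `c` along
-- the operations: relations because an annihilator is a submodule, representatives because the span
-- is unchanged. In size zero the determinant is 1 and there is a single coset.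
colDet-dichotomy : ∀ {n} (c : Vec (V n) n) →
  (colDet c ≡ 0ℤ × RowRelation c) ⊎ (colDet c ≢ 0ℤ × Transversal c ∣ colDet c ∣)
colDet-dichotomy {zero}  [] = inj₂ ((λ ()) , (λ _ ()) , (λ { zero zero _ → refl }) , λ _ → zero , (λ ()) , λ ())
colDet-dichotomy {suc n} c with clearRow c
... | v , c′ , s , null with v zero ℤ.≟ 0ℤ | colDet-dichotomy (dropRow c′)
...   | yes v₀≡0 | _ = inj₁
        ( trans eq (cong (_* colDet (dropRow c′)) v₀≡0)
        , map₂ (λ {x} → map₂ (↜-member (annihilator x) s)) (rowRelation-zero v c′ null v₀≡0))
  where eq = trans (alternating-↝ colDet (colDet-alternating {suc n}) s) (colDet-∷ null)
...   | no v₀≢0 | inj₁ (det≡0 , rel) = inj₁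
        ( trans eq (trans (cong (_*_ (v zero)) det≡0) (ℤ.*-zeroʳ (v zero)))
        , map₂ (λ {x} → map₂ (↜-member (annihilator x) s)) (rowRelation-suc v c′ null v₀≢0 rel))
  where eq = trans (alternating-↝ colDet (colDet-alternating {suc n}) s) (colDet-∷ null)
...   | no v₀≢0 | inj₂ (det≢0 , T) = inj₂
        ( (λ det≡0 → [ v₀≢0 , det≢0 ]′ (ℤ.i*j≡0⇒i≡0∨j≡0 (v zero) (trans (sym eq) det≡0)))
        , subst (Transversal c) (sym (trans (cong ∣_∣ eq) (ℤ.abs-* (v zero) (colDet (dropRow c′)))))
            (transversal-↜ s (transversal-∷ v c′ null v₀≢0 T)))
  where eq = trans (alternating-↝ colDet (colDet-alternating {suc n}) s) (colDet-∷ null)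

-- The Leibniz formula

-- Unfolding the nested subtractions yields the signs `-1ℤ ^ toℕ j`; this links the index-free
-- expansion to the indexed one in `det`.
laplace-tabulate : ∀ {n k} (ℓ : V n → ℤ) (g : Vec (V n) k → ℤ) (c : Fin (suc k) → V n) →
  laplace ℓ g (tabulate c) ≡ sum λ j → -1ℤ ^ toℕ j * (ℓ (c j) * g (tabulate (c ∘ punchIn j)))
laplace-tabulate {k = zero}  ℓ g c = single (ℓ (c zero) * g [])
  where
  single : ∀ x → x ≡ 1ℤ * x + 0ℤ
  single = solve-∀
laplace-tabulate {k = suc k} ℓ g c = begin
  h zero - laplace ℓ (g ∘ (c zero ∷_)) (tabulate (c ∘ suc))
    ≡⟨ cong (_-_ (h zero)) (laplace-tabulate ℓ (g ∘ (c zero ∷_)) (c ∘ suc)) ⟩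
  h zero - sum (λ j → -1ℤ ^ toℕ j * h (suc j))
    ≡⟨ negate (h zero) (sum λ j → -1ℤ ^ toℕ j * h (suc j)) ⟩
  1ℤ * h zero + -1ℤ * sum (λ j → -1ℤ ^ toℕ j * h (suc j))
    ≡⟨ cong (_+_ (1ℤ * h zero)) (trans (Addition.*-distribˡ-sum -1ℤ (λ j → -1ℤ ^ toℕ j * h (suc j)))
         (Addition.sum-cong-≗ λ j → sym (ℤ.*-assoc -1ℤ (-1ℤ ^ toℕ j) (h (suc j))))) ⟩
  1ℤ * h zero + sum (λ j → (-1ℤ * -1ℤ ^ toℕ j) * h (suc j))
    ∎
  where
  open ≡-Reasoning
  h : Fin (suc (suc k)) → ℤ
  h j = ℓ (c j) * g (tabulate (c ∘ punchIn j))
  negate : ∀ x y → x - y ≡ 1ℤ * x + -1ℤ * y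
  negate = solve-∀

columns : ∀ {m} → Matrix (Fin m) (Fin m) → Vec (V m) m
columns M = tabulate λ j i → M i j

det-columns : ∀ {m} (M : Matrix (Fin m) (Fin m)) → det M ≡ colDet (columns M)
det-columns {zero}  M = refl
det-columns {suc m} M = sym (trans
  (laplace-tabulate (λ v → v zero) (colDet ∘ dropRow) (λ j i → M i j))
  (Addition.sum-cong-≗ λ j → cong (λ z → -1ℤ ^ toℕ j * (M zero j * z)) (trans
    (cong colDet (sym (Vec.tabulate-∘ (_∘ suc) (λ k i → M i (punchIn j k)))))
    (sym (det-columns (λ i k → M (suc i) (punchIn j k)))))))

-- Finite sums and their independence of the enumeration

module Reindex {c ℓ} (M : CommutativeMonoid c ℓ) where
  open CommutativeMonoid M using (Carrier; _≈_; reflexive) renaming (sym to ≈-sym; trans to ≈-trans)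
  open BigOp M
  open Sum M using (sum-permute; sum-cong-≗) renaming (sum to sumᴹ)

  -- The chosen enumeration and the one from the `Finite` instance differ by a bijection of index
  -- sets, which a commutative sum ignores. In this way `α` and `β` take the place of the built-in
  -- orders.
  ⨁-reindex : ∀ {A : Set} {{fin : Finite A}} {n} (e : Fin n ↔ A) (f : A → Carrier) →
              ⨁ f ≈ sumᴹ (f ∘ Inverse.to e)
  ⨁-reindex {{fin}} e f = ≈-sym (≈-trans
    (sum-permute (f ∘ Inverse.to e) (↔-trans (Finite.enum fin) (↔-sym e)))
    (reflexive (sum-cong-≗ λ i → cong f (Inverse.strictlyInverseˡ e (Inverse.to (Finite.enum fin) i)))))

open Reindex ℤ.+-0-commutativeMonoid using () renaming (⨁-reindex to ∑-reindex)
open Reindex ℤ.*-1-commutativeMonoid using () renaming (⨁-reindex to ∏-reindex)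

module _ {c ℓ} (S : Setoid c ℓ) where
  open Setoid S using (Carrier; _≈_)

  sumOver-scale : ∀ (f : Carrier → ℤ) {z} t → SumOver S f z → SumOver S (λ x → t * f x) (t * z)
  sumOver-scale f t (N , e , eq) =
    N , e , trans (sym (Addition.*-distribˡ-sum t (f ∘ Inverse.to e))) (cong (t *_) eq)

  sumOver-cong : ∀ (f g : Carrier → ℤ) {z} → f ≗ g → SumOver S f z → SumOver S g z
  sumOver-cong f g f≗g (N , e , eq) = N , e , trans (sym (Addition.sum-cong-≗ (f≗g ∘ Inverse.to e))) eq

  -- Two enumerations of `S` differ by a bijection of indices. They are inverse only up to `_≈_`,
  -- whence the condition that `f` respect it.
  sumOver-unique : ∀ (f : Carrier → ℤ) {z w} → (∀ {x y} → x ≈ y → f x ≡ f y) →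
                   SumOver S f z → SumOver S f w → z ≡ w
  sumOver-unique f {z} {w} f-cong (N , e , eq) (N′ , e′ , eq′) = begin
    z                                                            ≡⟨ eq ⟨
    sum (f ∘ Inverse.to e)                                       ≡⟨ Addition.sum-cong-≗ (λ i →
                                                                      f-cong (Inverse.strictlyInverseˡ e′ (Inverse.to e i))) ⟨
    sum (f ∘ Inverse.to e′ ∘ Inverse.from e′ ∘ Inverse.to e)     ≡⟨ Addition.sum-permute (f ∘ Inverse.to e′)
                                                                      (Composition.inverse e (Symmetry.inverse e′)) ⟨
    sum (f ∘ Inverse.to e′)                                      ≡⟨ eq′ ⟩
    w                                                            ∎
    where open ≡-Reasoning

sumOver-transport : ∀ {a b c d} {S : Setoid a b} {U : Setoid c d} (i : Inverse S U)
  (f : Setoid.Carrier S → ℤ) (g : Setoid.Carrier U → ℤ) {z} →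
  (∀ x → f x ≡ g (Inverse.to i x)) → SumOver S f z → SumOver U g z
sumOver-transport i f g f≗g (N , e , eq) =
  N , Composition.inverse e i , trans (sym (Addition.sum-cong-≗ (f≗g ∘ Inverse.to e))) eq

sum-split : ∀ m {n} (f : Fin (m ℕ.+ n) → ℤ) → sum f ≡ sum (f ∘ (Fin._↑ˡ n)) + sum (f ∘ (m Fin.↑ʳ_))
sum-split zero    f = sym (ℤ.+-identityˡ (sum f))
sum-split (suc m) {n} f = trans (cong (_+_ (f zero)) (sum-split m (f ∘ suc)))
  (sym (ℤ.+-assoc (f zero) (sum (f ∘ suc ∘ (Fin._↑ˡ n))) (sum (f ∘ suc ∘ (m Fin.↑ʳ_)))))

sumOver-⊎ : ∀ {A B : Set} (f : A → ℤ) (g : B → ℤ) {z w} →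
  SumOver (≡.setoid A) f z → SumOver (≡.setoid B) g w → SumOver (≡.setoid (A ⊎ B)) [ f , g ]′ (z + w)
sumOver-⊎ f g (M , d , eq) (N , e , eq′) = M ℕ.+ N , ↔-trans Fin.+↔⊎ (d ⊎-cong e) ,
  trans (sum-split M (h ∘ Fin.splitAt M)) (cong₂ _+_
    (trans (Addition.sum-cong-≗ λ i → cong h (Fin.splitAt-↑ˡ M i N)) eq)
    (trans (Addition.sum-cong-≗ λ i → cong h (Fin.splitAt-↑ʳ M N i)) eq′))
  where
  h : Fin M ⊎ Fin N → ℤ
  h = [ f , g ]′ ∘ Inverse.to (d ⊎-cong e)

sumOver-Σ : ∀ {n} {B : Fin n → Set} (f : ∀ j → B j → ℤ) {z : Fin n → ℤ} →
  (∀ j → SumOver (≡.setoid (B j)) (f j) (z j)) → SumOver (≡.setoid (Σ (Fin n) B)) (uncurry f) (sum z)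
sumOver-Σ {zero}  f s = 0 , mk↔ₛ′ (λ ()) (λ ()) (λ ()) (λ ()) , refl
sumOver-Σ {suc n} f s = sumOver-transport
  (mk↔ₛ′ (λ { (inj₁ b) → zero , b ; (inj₂ (j , b)) → suc j , b })
         (λ { (zero , b) → inj₁ b ; (suc j , b) → inj₂ (j , b) })
         (λ { (zero , b) → refl ; (suc j , b) → refl })
         (λ { (inj₁ b) → refl ; (inj₂ (j , b)) → refl }))
  [ f zero , uncurry (f ∘ suc) ]′ (uncurry f)
  (λ { (inj₁ b) → refl ; (inj₂ (j , b)) → refl })
  (sumOver-⊎ (f zero) (uncurry (f ∘ suc)) (s zero) (sumOver-Σ (f ∘ suc) (s ∘ suc)))

-- `b` tells whether a matrix entry may be used. A forbidden entry leaves no codes, and the empty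
-- sum agrees with its term of the expansion only if that term is 0.
sumOver-T× : ∀ b {B : Set} (f : B → ℤ) {z} → (¬ T b → z ≡ 0ℤ) →
  SumOver (≡.setoid B) f z → SumOver (≡.setoid (T b × B)) (f ∘ proj₂) z
sumOver-T× true  f _   s = sumOver-transport
  (mk↔ₛ′ (tt ,_) proj₂ (λ _ → refl) (λ _ → refl)) f (f ∘ proj₂) (λ _ → refl) s
sumOver-T× false f z≡0 _ = 0 , mk↔ₛ′ (λ ()) (λ ()) (λ ()) (λ ()) , sym (z≡0 id)

-- Lehmer codes of the permutations π with P i (π i) for all i.
Code : ∀ m → (Fin m → Fin m → Bool) → Set
Code zero    P = ⊤
Code (suc m) P = Σ (Fin (suc m)) λ j → T (P zero j) × Code m (λ i k → P (suc i) (punchIn j k))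

decode : ∀ {m P} → Code m P → Permutation′ m
decode {zero}  _           = Perm.id
decode {suc m} (j , _ , c) = Perm.insert zero j (decode c)

decode-allowed : ∀ {m P} (c : Code m P) i → T (P i (decode c ⟨$⟩ʳ i))
decode-allowed {suc m} (j , p , c) zero    = p
decode-allowed {suc m} (j , p , c) (suc i) = decode-allowed c i

decode-injective : ∀ {m P} (c c′ : Code m P) → decode c Perm.≈ decode c′ → c ≡ c′
decode-injective {zero}      _           _             _  = refl
decode-injective {suc m} {P} (j , p , c) (j′ , p′ , c′) eq with eq zero
... | refl = cong₂ (λ p c → j , p , c) (Bool.T-irrelevant p p′)
  (decode-injective c c′ λ i → Fin.punchIn-injective j (decode c ⟨$⟩ʳ i) (decode c′ ⟨$⟩ʳ i) (eq (suc i)))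

decode-surjective : ∀ {m} P (π : Permutation′ m) → (∀ i → T (P i (π ⟨$⟩ʳ i))) →
                    Σ (Code m P) λ c → decode c Perm.≈ π
decode-surjective {zero}  P π ps = tt , λ ()
decode-surjective {suc m} P π ps =
  let c , eq = decode-surjective (λ i k → P (suc i) (punchIn (π ⟨$⟩ʳ zero) k)) (Perm.remove zero π)
                 (λ i → subst (T ∘ P (suc i)) (Perm.punchIn-permute π zero i) (ps (suc i)))
  in (π ⟨$⟩ʳ zero , ps zero , c) , λ
    { zero    → refl
    ; (suc i) → trans (cong (punchIn (π ⟨$⟩ʳ zero)) (eq i)) (sym (Perm.punchIn-permute π zero i)) }

leibnizTerm : ∀ {m} → Matrix (Fin m) (Fin m) → Permutation′ m → ℤ
leibnizTerm M π = permSign π * product λ i → M i (π ⟨$⟩ʳ i)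

-- The Laplace sign at column `j` is the one that `permSign-remove` yields at position `zero`, and
-- removing that position undoes the insertion.
leibnizTerm-insert : ∀ {m} (M : Matrix (Fin (suc m)) (Fin (suc m))) j π →
  (-1ℤ ^ toℕ j * M zero j) * leibnizTerm (λ i k → M (suc i) (punchIn j k)) π ≡
  leibnizTerm M (Perm.insert zero j π)
leibnizTerm-insert M j π = begin
  (s * a) * (permSign π * p)              ≡⟨ regroup s a (permSign π) p ⟩
  (1ℤ * s) * permSign π * (a * p)         ≡⟨ cong (λ z → (1ℤ * s) * z * (a * p))
                                               (permSign-cong (Perm.remove zero ρ) π (Perm.remove-insert zero j π)) ⟨
  (1ℤ * s) * permSign (Perm.remove zero ρ) * (a * p)
                                          ≡⟨ cong (_* (a * p)) (permSign-remove ρ zero) ⟨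
  permSign ρ * (a * p)                    ∎
  where
  open ≡-Reasoning
  ρ = Perm.insert zero j π
  s = -1ℤ ^ toℕ j
  a = M zero j
  p = product λ i → M (suc i) (punchIn j (π ⟨$⟩ʳ i))
  regroup : ∀ s a x p → (s * a) * (x * p) ≡ (1ℤ * s) * x * (a * p)
  regroup = solve-∀

-- Permutations that meet a forbidden entry are left out from the start, since their terms vanish.
-- With incidence as `P`, the codes that remain are the fitting orientations.
leibniz : ∀ {m} P (M : Matrix (Fin m) (Fin m)) → (∀ i j → ¬ T (P i j) → M i j ≡ 0ℤ) →
          SumOver (≡.setoid (Code m P)) (leibnizTerm M ∘ decode) (det M)
leibniz {zero}  P M null = 1 , mk↔ₛ′ (λ _ → tt) (λ _ → zero) (λ _ → refl) (λ { zero → refl }) , refl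
leibniz {suc m} P M null = sumOver-cong (≡.setoid (Code (suc m) P))
  (λ (j , _ , c) → term j c) (leibnizTerm M ∘ decode {P = P})
  (λ (j , _ , c) → leibnizTerm-insert M j (decode c))
  (sumOver-Σ (λ j → term j ∘ proj₂) λ j → sumOver-T× (P zero j) (term j) (λ ¬p → vanish j (null zero j ¬p))
    (subst (SumOver (≡.setoid (Code m (minorP j))) (term j)) (ℤ.*-assoc (-1ℤ ^ toℕ j) (M zero j) (det (minor j)))
      (sumOver-scale (≡.setoid (Code m (minorP j))) (leibnizTerm (minor j) ∘ decode) (-1ℤ ^ toℕ j * M zero j)
        (leibniz (minorP j) (minor j) (λ i k → null (suc i) (punchIn j k))))))
  where
  minorP : Fin (suc m) → Fin m → Fin m → Bool
  minorP j i k = P (suc i) (punchIn j k)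
  minor : Fin (suc m) → Matrix (Fin m) (Fin m)
  minor j i k = M (suc i) (punchIn j k)
  term : ∀ j → Code m (minorP j) → ℤ
  term j c = (-1ℤ ^ toℕ j * M zero j) * leibnizTerm (minor j) (decode c)
  vanish : ∀ j → M zero j ≡ 0ℤ → -1ℤ ^ toℕ j * (M zero j * det (minor j)) ≡ 0ℤ
  vanish j M≡0 = trans (cong (λ z → -1ℤ ^ toℕ j * (z * det (minor j))) M≡0) (ℤ.*-zeroʳ (-1ℤ ^ toℕ j))

-- Incidence numbers

⊆-card : ∀ {n} (r f : Subset n) → r ⊆ f → card f ≡ card r → r ≡ f
⊆-card []            []            _   _  = refl
⊆-card (inside  ∷ r) (inside  ∷ f) r⊆f eq = cong (inside ∷_)
  (⊆-card r f (Subset.drop-∷-⊆ r⊆f) (ℕ.suc-injective eq))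
⊆-card (outside ∷ r) (outside ∷ f) r⊆f eq = cong (outside ∷_) (⊆-card r f (Subset.drop-∷-⊆ r⊆f) eq)
⊆-card (inside  ∷ r) (outside ∷ f) r⊆f _  = contradiction (r⊆f here) λ ()
⊆-card (outside ∷ r) (inside  ∷ f) r⊆f eq =
  contradiction (Subset.p⊆q⇒∣p∣≤∣q∣ (Subset.drop-∷-⊆ r⊆f)) (ℕ.<⇒≱ (ℕ.≤-reflexive eq))

⊆-remove : ∀ {n} (r f : Subset n) → r ⊆ f → card f ≡ suc (card r) → ∃[ v ] v ∈ f × r ≡ f ∖ v
⊆-remove (inside  ∷ r) (inside  ∷ f) r⊆f eq with ⊆-remove r f (Subset.drop-∷-⊆ r⊆f) (ℕ.suc-injective eq)
... | v , v∈f , r≡ = suc v , there v∈f , cong (inside ∷_) r≡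
⊆-remove (outside ∷ r) (outside ∷ f) r⊆f eq with ⊆-remove r f (Subset.drop-∷-⊆ r⊆f) eq
... | v , v∈f , r≡ = suc v , there v∈f , cong (outside ∷_) r≡
⊆-remove (inside  ∷ r) (outside ∷ f) r⊆f _  = contradiction (r⊆f here) λ ()
⊆-remove (outside ∷ r) (inside  ∷ f) r⊆f eq = zero , here , cong (outside ∷_)
  (trans (⊆-card r f (Subset.drop-∷-⊆ r⊆f) (ℕ.suc-injective eq)) (sym (Subset.p─⊥≡p f)))

module _ {n} (r f : Subset n) where

  incidence-⊆ : r ⊆ f → card f ≡ suc (card r) → IsSign (incidence r f)
  incidence-⊆ r⊆f eq with Fin.any? (λ j → Vec.≡-dec Bool._≟_ r (f ∖ List.lookup (vertices f) j))
  ... | yes (j , _) = -1^-sign (toℕ j)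
  ... | no  ∄j      = contradiction (Any.index v∈ , trans r≡ (cong (f ∖_) (lookup-index v∈))) ∄j
    where
    r≡ = proj₂ (proj₂ (⊆-remove r f r⊆f eq))
    v∈ = ∈-filter⁺ (Subset._∈? f) (∈-allFin (proj₁ (⊆-remove r f r⊆f eq))) (proj₁ (proj₂ (⊆-remove r f r⊆f eq)))

  incidence-⊈ : ¬ r ⊆ f → incidence r f ≡ 0ℤ
  incidence-⊈ r⊈f with Fin.any? (λ j → Vec.≡-dec Bool._≟_ r (f ∖ List.lookup (vertices f) j))
  ... | yes (j , refl) = ⊥-elim (r⊈f (Subset.p─q⊆p f ⁅ List.lookup (vertices f) j ⁆))
  ... | no  _          = refl

face-card : ∀ {n} {G : SimplicialComplex n} {k} (s : Face G k) → card (value s) ≡ k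
face-card {G = G} {k} (s , [ p ]) =
  -- The membership proof in `El` is irrelevant; decidability of equality on ℕ makes the cardinality
  -- usable again.
  recompute (card s ℕ.≟ k) (ℕ.≡ᵇ⇒≡ (card s) k (proj₂ (Equivalence.to Bool.T-∧ p)))

∂-⊆ : ∀ {n} (G : SimplicialComplex n) {k} (r : Face G k) (f : Face G (suc k)) →
      value r ⊆ value f → IsSign (∂ G r f)
∂-⊆ G r f r⊆f = incidence-⊆ (value r) (value f) r⊆f
  (trans (face-card {G = G} f) (cong suc (sym (face-card {G = G} r))))

-- Independence over ℝ and over ℤ

-- `a / 1` is normalised through a gcd, so this and the next two facts are checked on unnormalised
-- fractions with denominator 1.
/1-injective : ∀ {a b} → a ℚ./ 1 ≡ b ℚ./ 1 → a ≡ b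
/1-injective {a} {b} eq with ℚᵘ.≃-trans (ℚᵘ.≃-sym (ℚ.toℚᵘ-fromℚᵘ (mkℚᵘ a 0)))
  (ℚᵘ.≃-trans (ℚᵘ.≃-reflexive (cong ℚ.toℚᵘ eq)) (ℚ.toℚᵘ-fromℚᵘ (mkℚᵘ b 0)))
... | *≡* eq′ = trans (sym (ℤ.*-identityʳ a)) (trans eq′ (ℤ.*-identityʳ b))

/1-homo-+ : ∀ a b → (a ℚ./ 1) ℚ.+ (b ℚ./ 1) ≡ (a + b) ℚ./ 1
/1-homo-+ a b = ℚ.toℚᵘ-injective (begin
  ℚ.toℚᵘ (a ℚ./ 1 ℚ.+ b ℚ./ 1)             ≈⟨ ℚ.toℚᵘ-homo-+ (a ℚ./ 1) (b ℚ./ 1) ⟩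
  ℚ.toℚᵘ (a ℚ./ 1) ℚᵘ.+ ℚ.toℚᵘ (b ℚ./ 1)   ≈⟨ ℚᵘ.+-cong (ℚ.toℚᵘ-fromℚᵘ (mkℚᵘ a 0)) (ℚ.toℚᵘ-fromℚᵘ (mkℚᵘ b 0)) ⟩
  mkℚᵘ a 0 ℚᵘ.+ mkℚᵘ b 0                   ≡⟨ cong (λ z → mkℚᵘ z 0) (cong₂ _+_ (ℤ.*-identityʳ a) (ℤ.*-identityʳ b)) ⟩
  mkℚᵘ (a + b) 0                           ≈⟨ ℚ.toℚᵘ-fromℚᵘ (mkℚᵘ (a + b) 0) ⟨
  ℚ.toℚᵘ ((a + b) ℚ./ 1)                   ∎)
  where open ℚᵘ.≃-Reasoning

/1-homo-* : ∀ a b → (a ℚ./ 1) ℚ.* (b ℚ./ 1) ≡ (a * b) ℚ./ 1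
/1-homo-* a b = ℚ.toℚᵘ-injective (begin
  ℚ.toℚᵘ ((a ℚ./ 1) ℚ.* (b ℚ./ 1))           ≈⟨ ℚ.toℚᵘ-homo-* (a ℚ./ 1) (b ℚ./ 1) ⟩
  ℚ.toℚᵘ (a ℚ./ 1) ℚᵘ.* ℚ.toℚᵘ (b ℚ./ 1)   ≈⟨ ℚᵘ.*-cong (ℚ.toℚᵘ-fromℚᵘ (mkℚᵘ a 0)) (ℚ.toℚᵘ-fromℚᵘ (mkℚᵘ b 0)) ⟩
  mkℚᵘ (a * b) 0                           ≈⟨ ℚ.toℚᵘ-fromℚᵘ (mkℚᵘ (a * b) 0) ⟨
  ℚ.toℚᵘ ((a * b) ℚ./ 1)                   ∎)
  where open ℚᵘ.≃-Reasoning

pointwise⇒≈ᴿ : ∀ x y → seq x ≗ seq y → x ≈ᴿ y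
pointwise⇒≈ᴿ x y x≗y ε ε>0 = 0 , λ n _ → subst (λ z → ℚ.∣ z ∣ ℚ.< ε)
  (sym (trans (cong (λ z → z ℚ.- seq y n) (x≗y n)) (ℚ.+-inverseʳ (seq y n)))) ε>0

fromℚ-injective : ∀ p q → fromℚ p ≈ᴿ fromℚ q → p ≡ q
fromℚ-injective p q p≈q with p ℚ.- q ℚ.≟ 0ℚ
... | yes p-q≡0 = x∙y⁻¹≈ε⇒x≈y p q p-q≡0
  where open import Algebra.Properties.Group ℚ.+-0-group using (x∙y⁻¹≈ε⇒x≈y)
-- The difference sequence is constant, so with `∣ p - q ∣` itself as the tolerance it would be
-- smaller than itself.
... | no  p-q≢0 = let N , small = p≈q ℚ.∣ p ℚ.- q ∣ 0<∣p-q∣ in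
  contradiction (small N ℕ.≤-refl) (ℚ.<-irrefl refl)
  where
  0<∣p-q∣ : 0ℚ ℚ.< ℚ.∣ p ℚ.- q ∣
  0<∣p-q∣ = ℚ.≰⇒> λ ≤0 → p-q≢0 (ℚ.∣p∣≡0⇒p≡0 (p ℚ.- q) (ℚ.≤-antisym ≤0 (ℚ.0≤∣p∣ (p ℚ.- q))))

module ℝ-ring = CommutativeRing ℝ-commutativeRing

module _ {c ℓ} (K : CommutativeRing c ℓ) where
  private module K = CommutativeRing K
  open LinearAlgebra K using () renaming (LinearlyIndependent to LinearlyIndependentᴷ)
  open Sum K.+-commutativeMonoid using () renaming (sum to sumᴷ)

  -- The map `ι` preserves 0, sums and products, so it sends an integer relation to a relation over
  -- `K`. Independence makes the images of the coefficients zero, and the trivial kernel of `ι`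
  -- makes the coefficients zero.
  independent-ℤ : (ι : ℤ → K.Carrier) → ι 0ℤ K.≈ K.0# →
    (∀ a b → ι a K.+ ι b K.≈ ι (a + b)) → (∀ a b → ι a K.* ι b K.≈ ι (a * b)) →
    (∀ a → ι a K.≈ K.0# → a ≡ 0ℤ) →
    ∀ {I J : Set} {{fin : Finite I}} (v : I → J → K.Carrier) → LinearlyIndependentᴷ v →
    ∀ {m} (α : Fin m ↔ I) (A : Fin m → J → ℤ) → (∀ i j → v (Inverse.to α i) j K.≈ ι (A i j)) →
    ∀ x → (∀ j → dot x (λ i → A i j) ≡ 0ℤ) → ∀ i → x i ≡ 0ℤ
  independent-ℤ ι ι-0 ι-+ ι-* ι-injective v independent α A v≈A x kernel i =
    ι-injective (x i) (K.trans (K.reflexive (cong (ι ∘ x) (sym (strictlyInverseʳ i))))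
      (independent (ι ∘ x ∘ from) null (to i)))
    where
    open Inverse α
    open BigOp K.+-commutativeMonoid
    open Reindex K.+-commutativeMonoid
    open import Relation.Binary.Reasoning.Setoid K.setoid
    ι-sum : ∀ {k} (g : Fin k → K.Carrier) (f : Fin k → ℤ) → (∀ i → g i K.≈ ι (f i)) → sumᴷ g K.≈ ι (sum f)
    ι-sum {zero}  g f g≈f = K.sym ι-0
    ι-sum {suc k} g f g≈f = K.trans
      (K.+-cong (g≈f zero) (ι-sum (g ∘ suc) (f ∘ suc) (g≈f ∘ suc)))
      (ι-+ (f zero) (sum (f ∘ suc)))
    null : ∀ j → (⨁ λ r → ι (x (from r)) K.* v r j) K.≈ K.0#
    null j = begin
      (⨁ λ r → ι (x (from r)) K.* v r j)
        ≈⟨ ⨁-reindex α (λ r → ι (x (from r)) K.* v r j) ⟩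
      sumᴷ (λ i → ι (x (from (to i))) K.* v (to i) j)
        ≈⟨ ι-sum (λ i → ι (x (from (to i))) K.* v (to i) j) (λ i → x i * A i j) (λ i → K.trans
             (K.*-cong (K.reflexive (cong (ι ∘ x) (strictlyInverseʳ i))) (v≈A i j))
             (ι-* (x i) (A i j))) ⟩
      ι (dot x (λ i → A i j))
        ≡⟨ cong ι (kernel j) ⟩
      ι 0ℤ
        ≈⟨ ι-0 ⟩
      K.0#
        ∎

fromℤ-+ : ∀ a b → fromℤ a ℝ-ring.+ fromℤ b ℝ-ring.≈ fromℤ (a + b)
fromℤ-+ a b = pointwise⇒≈ᴿ (fromℤ a ℝ-ring.+ fromℤ b) (fromℤ (a + b)) (λ _ → /1-homo-+ a b)

fromℤ-* : ∀ a b → fromℤ a ℝ-ring.* fromℤ b ℝ-ring.≈ fromℤ (a * b)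
fromℤ-* a b = pointwise⇒≈ᴿ (fromℤ a ℝ-ring.* fromℤ b) (fromℤ (a * b)) (λ _ → /1-homo-* a b)

fromℤ-injective : ∀ z → fromℤ z ℝ-ring.≈ ℝ-ring.0# → z ≡ 0ℤ
fromℤ-injective z z≈0 = /1-injective {z} {0ℤ} (fromℚ-injective (z ℚ./ 1) 0ℚ z≈0)

-- In a record, so that unification rather than instance search supplies the Finite instance: two
-- elaborations of the instance for El (R ᶜ) agree only after unfolding, which is infeasible.
-- IsSum and IsSignedProduct serve the same purpose.
record IndependentFamily {I J : Set} {{_ : Finite I}} (v : I → J → ℝ) : Set where
  constructor family
  field
    independent : LinearlyIndependent v

independent-ℝ : ∀ {I J : Set} {{fin : Finite I}} {v : I → J → ℝ} → IndependentFamily v →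
  ∀ {m} (α : Fin m ↔ I) (A : Fin m → J → ℤ) → (∀ i j → v (Inverse.to α i) j ℝ-ring.≈ fromℤ (A i j)) →
  ∀ x → (∀ j → dot x (λ i → A i j) ≡ 0ℤ) → ∀ i → x i ≡ 0ℤ
independent-ℝ {v = v} (family independent) = independent-ℤ ℝ-commutativeRing fromℤ
  (pointwise⇒≈ᴿ (fromℤ 0ℤ) ℝ-ring.0# (λ _ → refl)) fromℤ-+ fromℤ-* fromℤ-injective v independent

module _ {c ℓ} {A : Set} (S : Setoid c ℓ) (to : A → Setoid.Carrier S)
  (injective : ∀ {a b} → Setoid._≈_ S (to a) (to b) → a ≡ b)
  (surjective : ∀ y → ∃[ a ] Setoid._≈_ S (to a) y) where

  bijection⇒inverse : Inverse (≡.setoid A) S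
  bijection⇒inverse = record
    { to        = to
    ; from      = from
    ; to-cong   = λ { refl → Setoid.refl S }
    ; from-cong = λ {x} {y} x≈y → injective (Setoid.trans S (to-from x)
                    (Setoid.trans S x≈y (Setoid.sym S (to-from y))))
    ; inverse   = (λ { {x} refl → to-from x })
                , (λ {a} {y} y≈ → injective (Setoid.trans S (to-from y) y≈))
    }
    where
    from = proj₁ ∘ surjective
    to-from : ∀ y → Setoid._≈_ S (to (from y)) y
    to-from = proj₂ ∘ surjective

signum-sign : ∀ {z} → z ≢ 0ℤ → IsSign (signum z)
signum-sign {+0}       z≢0 = contradiction refl z≢0
signum-sign {+[1+ _ ]} _   = inj₁ refl
signum-sign { -[1+ _ ]} _  = inj₂ refl

signum-*-self : ∀ z → signum z * z ≡ + ∣ z ∣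
signum-*-self +0       = refl
signum-*-self +[1+ n ] = ℤ.*-identityˡ +[1+ n ]
signum-*-self -[1+ n ] = ℤ.-1*i≡-i -[1+ n ]

signum-sign-* : ∀ {s} z → IsSign s → signum (s * z) ≡ s * signum z
signum-sign-* z (inj₁ refl) = trans (cong signum (ℤ.*-identityˡ z)) (sym (ℤ.*-identityˡ (signum z)))
signum-sign-* z (inj₂ refl) = trans (cong signum (ℤ.-1*i≡-i z)) (trans (signum-neg z) (sym (ℤ.-1*i≡-i (signum z))))
  where
  signum-neg : ∀ z → signum (- z) ≡ - signum z
  signum-neg +0       = refl
  signum-neg +[1+ _ ] = refl
  signum-neg -[1+ _ ] = refl

-- Relative homology

record IsSum {A : Set} {{_ : Finite A}} (f : A → ℤ) (z : ℤ) : Set where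
  constructor isSum
  field
    equation : z ≡ ∑ f

isSum-reindex : ∀ {A : Set} {{fin : Finite A}} {n} (e : Fin n ↔ A) {f : A → ℤ} {z} →
                IsSum f z → z ≡ sum (f ∘ Inverse.to e)
isSum-reindex e {f} (isSum eq) = trans eq (∑-reindex e f)

module _ {n d} (G : SimplicialComplex n) (F : Sub (Face G (suc d))) (R : Sub (Face G d)) where

  boundary-isSum : ∀ x r → IsSum (λ f → x f * ∂ G r (value f)) (boundary G F R x r)
  boundary-isSum x r = isSum refl

  rows-independent : IsRootedForest G F R → IndependentFamily (row G F (R ᶜ))
  rows-independent (_ , independent , _) = family independent

  module _ {m} (α : Fin m ↔ El (R ᶜ)) (β : Fin m ↔ El F) where

    private
      module α = Inverse α
      module β = Inverse β
      M = orderedMatrix G F R α β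
      c = columns M

    -- Since `β` reaches every face of `F`, a relation on the ordered matrix is an integer relation
    -- among the rows indexed by the complement of `R`, which the root condition rules out.
    ¬rowRelation : IsRootedForest G F R → ¬ RowRelation c
    ¬rowRelation rooted (x , (i , xᵢ≢0) , ps) = xᵢ≢0
      (independent-ℝ {{_}} (rows-independent rooted) α A
        (λ i f → pointwise⇒≈ᴿ (row G F (R ᶜ) (α.to i) f) (fromℤ (A i f)) (λ _ → refl)) x kernel i)
      where
      A : Fin m → El F → ℤ
      A i f = ∂ G (value (α.to i)) (value f)
      kernel : ∀ f → dot x (λ i → A i f) ≡ 0ℤ
      kernel f = begin
        dot x (λ i → A i f)
          ≡⟨ Addition.sum-cong-≗ (λ i → cong (λ g → x i * A i g) (sym (β.strictlyInverseˡ f))) ⟩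
        dot x (λ i → M i (β.from f))
          ≡⟨ Addition.sum-cong-≗ (λ i → cong (λ v → x i * v i)
               (sym (Vec.lookup∘tabulate (λ j i → M i j) (β.from f)))) ⟩
        dot x (lookup c (β.from f))
          ≡⟨ All.lookup⁺ ps (β.from f) ⟩
        0ℤ
          ∎
        where open ≡-Reasoning

    det≢0 : IsRootedForest G F R → det M ≢ 0ℤ
    det≢0 rooted det≡0 =
      [ ¬rowRelation rooted ∘ proj₂ , (λ (colDet≢0 , _) → colDet≢0 (trans (sym (det-columns M)) det≡0)) ]′
      (colDet-dichotomy c)

    private
      module H = AbelianGroup (RelativeHomology G F R)

    restrict : (Face G d → ℤ) → V m
    restrict x i = x (value (α.to i))

    extend : V m → Face G d → ℤ
    extend v r with T? ((R ᶜ) r)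
    ... | yes p = v (α.from (r , [ p ]))
    -- On `R` the value is arbitrary: it disappears modulo ℤR.
    ... | no  _ = 0ℤ

    restrict-extend : ∀ v → restrict (extend v) ≗ v
    restrict-extend v i with T? ((R ᶜ) (value (α.to i)))
    ... | yes p = cong v (α.strictlyInverseʳ i)
    ... | no ¬p = contradiction-irr (α.to i) ¬p
      where
      contradiction-irr : ∀ {w} {W : Set w} (r : El (R ᶜ)) → ¬ T ((R ᶜ) (value r)) → W
      contradiction-irr (r , [ p ]) ¬p = ⊥-elim-irr (¬p p)

    boundary-restrict : ∀ x → restrict (boundary G F R x) ≗ lincomb (x ∘ β.to) c
    boundary-restrict x i = trans
      (isSum-reindex {{_}} β (boundary-isSum x (value (α.to i))))
      (Addition.sum-cong-≗ λ j → cong (λ v → x (β.to j) * v i) (sym (Vec.lookup∘tabulate (λ j i → M i j) j)))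

    -- Modulo ℤR only the coordinates outside `R` count, and there, read in the order `α`,
    -- boundaries are the combinations of the columns. With the converse below, `restrict`
    -- identifies the relative homology with ℤᵐ modulo the column lattice.
    homologous⇒inSpan : ∀ {x y} → x H.≈ y → InSpan c (λ i → restrict x i - restrict y i)
    homologous⇒inSpan {x} {y} (z , p) = z ∘ β.to , λ i → trans (sym (boundary-restrict z i))
      (on-complement (α.to i))
      where
      on-complement : (r : El (R ᶜ)) → boundary G F R z (value r) ≡ x (value r) - y (value r)
      on-complement (r , [ q ]) = ℤ.i-j≡0⇒i≡j (boundary G F R z r) (x r - y r)
        (p r (recompute (T? ((R ᶜ) r)) q))

    inSpan⇒homologous : ∀ {x y} → InSpan c (λ i → restrict x i - restrict y i) → x H.≈ y
    inSpan⇒homologous {x} {y} (w , p) = w ∘ β.from , λ r q → ℤ.i≡j⇒i-j≡0 (on-complement (r , [ q ]))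
      where
      on-complement : (r : El (R ᶜ)) → boundary G F R (w ∘ β.from) (value r) ≡ x (value r) - y (value r)
      on-complement r = subst (λ r → boundary G F R (w ∘ β.from) (value r) ≡ x (value r) - y (value r))
        (α.strictlyInverseˡ r) (begin
          restrict (boundary G F R (w ∘ β.from)) (α.from r)  ≡⟨ boundary-restrict (w ∘ β.from) (α.from r) ⟩
          lincomb (w ∘ β.from ∘ β.to) c (α.from r)           ≡⟨ Addition.sum-cong-≗ (λ j →
                                                                 cong (λ k → w k * lookup c j (α.from r)) (β.strictlyInverseʳ j)) ⟩
          lincomb w c (α.from r)                             ≡⟨ p (α.from r) ⟩
          restrict x (α.from r) - restrict y (α.from r)      ∎)
        where open ≡-Reasoning

    transversal⇒cardinality : ∀ {N} → Transversal c N → H.setoid HasCardinality N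
    transversal⇒cardinality (e , inj , surj) = bijection⇒inverse H.setoid (extend ∘ e)
      (λ {a} {b} a≈b → inj a b (Submodule.resp (span c)
        (λ i → cong₂ _-_ (restrict-extend (e a) i) (restrict-extend (e b) i))
        (homologous⇒inSpan {extend (e a)} {extend (e b)} a≈b)))
      (λ x → let a , p = surj (restrict x) in a , H.sym {x} {extend (e a)} (inSpan⇒homologous {x} {extend (e a)}
        (Submodule.resp (span c) (λ i → cong (_-_ (restrict x i)) (sym (restrict-extend (e a) i))) p)))

    homology-cardinality : IsRootedForest G F R → H.setoid HasCardinality ∣ det M ∣
    homology-cardinality rooted =
      [ (λ (_ , rel) → contradiction rel (¬rowRelation rooted))
      , (λ (_ , T) → subst (H.setoid HasCardinality_) (cong ∣_∣ (sym (det-columns M))) (transversal⇒cardinality T)) ]′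
      (colDet-dichotomy c)

-- Fitting orientations

record IsSignedProduct {A : Set} {{_ : Finite A}} (s : ℤ) (f : A → ℤ) (z : ℤ) : Set where
  constructor isSignedProduct
  field
    equation : z ≡ s * ∏ f

isSignedProduct-reindex : ∀ {A : Set} {{fin : Finite A}} {n} (e : Fin n ↔ A) {s} {f : A → ℤ} {z} →
                          IsSignedProduct s f z → z ≡ s * product (f ∘ Inverse.to e)
isSignedProduct-reindex e {s} {f} (isSignedProduct eq) = trans eq (cong (_*_ s) (∏-reindex e f))

module _ {n d} (G : SimplicialComplex n) (F : Sub (Face G (suc d))) (R : Sub (Face G d)) where

  unnormalisedSign-isSignedProduct : ∀ {m} (α : Fin m ↔ El (R ᶜ)) (β : Fin m ↔ El F) φ →
    IsSignedProduct (permSign (π[_] G F R α β φ)) (λ r → ∂ G (value r) (value (apply φ r)))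
                    (unnormalisedSign G F R α β φ)
  unnormalisedSign-isSignedProduct α β φ = isSignedProduct refl

  entries : ∀ {m} → (Fin m ↔ El (R ᶜ)) → FittingOrientation G F R → Fin m → ℤ
  entries α φ i = ∂ G (value (Inverse.to α i)) (value (apply φ (Inverse.to α i)))

  -- The product of entries does not depend on the order of the rows, so it may be taken along `α`
  -- while the permutation is taken with respect to `α′`. Signs for two orders thereby share the
  -- same product.
  unnormalisedSign-reindex : ∀ {m} (α α′ : Fin m ↔ El (R ᶜ)) (β : Fin m ↔ El F) φ →
    unnormalisedSign G F R α′ β φ ≡ permSign (π[_] G F R α′ β φ) * product (entries α φ)
  unnormalisedSign-reindex α α′ β φ =
    isSignedProduct-reindex {{_}} α (unnormalisedSign-isSignedProduct α′ β φ)

  unnormalisedSign-sign : ∀ {m} (α : Fin m ↔ El (R ᶜ)) (β : Fin m ↔ El F) φ →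
    IsSign (unnormalisedSign G F R α β φ)
  unnormalisedSign-sign α β φ = subst IsSign (sym (unnormalisedSign-reindex α α β φ))
    (sign-* (permSign-sign (π[_] G F R α β φ))
      (product-sign (entries α φ) λ i → ∂-⊆ G (value (Inverse.to α i)) (value (apply φ (Inverse.to α i)))
        (fits φ (Inverse.to α i))))

  unnormalisedSign-cong : ∀ {m} (α : Fin m ↔ El (R ᶜ)) (β : Fin m ↔ El F) φ ψ →
    apply φ ≗ apply ψ → unnormalisedSign G F R α β φ ≡ unnormalisedSign G F R α β ψ
  unnormalisedSign-cong α β φ ψ φ≗ψ = trans (unnormalisedSign-reindex α α β φ) (trans
    (cong₂ _*_
      (permSign-cong (π[_] G F R α β φ) (π[_] G F R α β ψ) (λ i → cong (Inverse.from β) (φ≗ψ (Inverse.to α i))))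
      (Product.sum-cong-≗ λ i → cong (λ f → ∂ G (value (Inverse.to α i)) (value f)) (φ≗ψ (Inverse.to α i))))
    (sym (unnormalisedSign-reindex α α β ψ)))

  module _ {m} (α : Fin m ↔ El (R ᶜ)) (β : Fin m ↔ El F) where

    private
      module α = Inverse α
      module β = Inverse β
      M = orderedMatrix G F R α β

    incident? : ∀ i j → Dec (value (value (α.to i)) ⊆ value (value (β.to j)))
    incident? i j = value (value (α.to i)) Subset.⊆? value (value (β.to j))

    incident : Fin m → Fin m → Bool
    incident i j = ⌊ incident? i j ⌋

    incident-from : ∀ i f → value (value (α.to i)) ⊆ value (value f) → T (incident i (β.from f))
    incident-from i f r⊆f = fromWitness {a? = incident? i (β.from f)}
      λ {x} x∈r → subst (λ g → x ∈ value (value g)) (sym (β.strictlyInverseˡ f)) (r⊆f x∈r)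

    orientation : Code m incident → FittingOrientation G F R
    orientation c = record
      { bijection = ↔-trans (↔-sym α) (↔-trans (decode c) β)
      ; fits      = λ r {x} x∈r → toWitness {a? = incident? (α.from r) (decode c ⟨$⟩ʳ α.from r)}
                      (decode-allowed c (α.from r))
                      (subst (λ r′ → x ∈ value (value r′)) (sym (α.strictlyInverseˡ r)) x∈r)
      }

    orientation-injective : ∀ {c c′} → apply (orientation c) ≗ apply (orientation c′) → c ≡ c′
    orientation-injective {c} {c′} eq = decode-injective c c′ λ i → begin
      decode c ⟨$⟩ʳ i                                    ≡⟨ cong (decode c ⟨$⟩ʳ_) (α.strictlyInverseʳ i) ⟨
      decode c ⟨$⟩ʳ (α.from (α.to i))                    ≡⟨ β.strictlyInverseʳ _ ⟨
      β.from (β.to (decode c ⟨$⟩ʳ (α.from (α.to i))))    ≡⟨ cong β.from (eq (α.to i)) ⟩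
      β.from (β.to (decode c′ ⟨$⟩ʳ (α.from (α.to i))))   ≡⟨ β.strictlyInverseʳ _ ⟩
      decode c′ ⟨$⟩ʳ (α.from (α.to i))                   ≡⟨ cong (decode c′ ⟨$⟩ʳ_) (α.strictlyInverseʳ i) ⟩
      decode c′ ⟨$⟩ʳ i                                   ∎
      where open ≡-Reasoning

    orientation-surjective : ∀ φ → ∃[ c ] apply (orientation c) ≗ apply φ
    orientation-surjective φ =
      let c , eq = decode-surjective incident (π[_] G F R α β φ)
                     (λ i → incident-from i (apply φ (α.to i)) (fits φ (α.to i)))
      in c , λ r → trans (cong β.to (eq (α.from r)))
                     (trans (β.strictlyInverseˡ (apply φ (α.to (α.from r))))
                            (cong (apply φ) (α.strictlyInverseˡ r)))

    unnormalisedSign-orientation : ∀ c → leibnizTerm M (decode c) ≡ unnormalisedSign G F R α β (orientation c)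
    unnormalisedSign-orientation c = sym (trans (unnormalisedSign-reindex α α β (orientation c)) (cong₂ _*_
      (permSign-cong (π[_] G F R α β (orientation c)) (decode c) λ i →
        trans (β.strictlyInverseʳ _) (cong (decode c ⟨$⟩ʳ_) (α.strictlyInverseʳ i)))
      (Product.sum-cong-≗ λ i → cong (λ k → M i (decode c ⟨$⟩ʳ k)) (α.strictlyInverseʳ i))))

    sumOver-unnormalisedSign : SumOver (FittingOrientations G F R) (unnormalisedSign G F R α β) (det M)
    sumOver-unnormalisedSign = sumOver-transport
      (bijection⇒inverse (FittingOrientations G F R) orientation orientation-injective orientation-surjective)
      (λ c → leibnizTerm M (decode c)) (unnormalisedSign G F R α β) unnormalisedSign-orientation
      (leibniz incident M λ i j ¬⊆ → incidence-⊈ (value (value (α.to i))) (value (value (β.to j)))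
        λ r⊆f → ¬⊆ (fromWitness {a? = incident? i j} r⊆f))

    sumOver-Λ : SumOver (FittingOrientations G F R) (Λ G F R α β) (+ ∣ det M ∣)
    sumOver-Λ = subst (SumOver (FittingOrientations G F R) (Λ G F R α β)) (signum-*-self (det M))
      (sumOver-scale (FittingOrientations G F R) (unnormalisedSign G F R α β) (signum (det M))
        sumOver-unnormalisedSign)

    Λ-sign : IsRootedForest G F R → ∀ φ → IsSign (Λ G F R α β φ)
    Λ-sign rooted φ = sign-* (signum-sign (det≢0 G F R α β rooted)) (unnormalisedSign-sign α β φ)

  module _ {m} (α α′ : Fin m ↔ El (R ᶜ)) (β β′ : Fin m ↔ El F) where

    private
      σ τ : Permutation′ m
      σ = ↔-trans α′ (↔-sym α)
      τ = ↔-trans β (↔-sym β′)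
      s = permSign σ * permSign τ

    reordering-sign : IsSign s
    reordering-sign = sign-* (permSign-sign σ) (permSign-sign τ)

    -- The permutation of `φ` in the new orders is the old one preceded by `σ` and followed by `τ`,
    -- the changes of order on rows and columns.
    unnormalisedSign-reorder : ∀ φ → s * unnormalisedSign G F R α β φ ≡ unnormalisedSign G F R α′ β′ φ
    unnormalisedSign-reorder φ = begin
      s * unnormalisedSign G F R α β φ
        ≡⟨ cong (_*_ s) (unnormalisedSign-reindex α α β φ) ⟩
      s * (permSign π * p)
        ≡⟨ regroup (permSign σ) (permSign τ) (permSign π) p ⟩
      permSign σ * (permSign π * permSign τ) * p
        ≡⟨ cong (λ z → permSign σ * z * p) (permSign-∘ π τ) ⟨
      permSign σ * permSign (π ∘ₚ τ) * p
        ≡⟨ cong (λ z → z * p) (permSign-∘ σ (π ∘ₚ τ)) ⟨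
      permSign (σ ∘ₚ (π ∘ₚ τ)) * p
        ≡⟨ cong (λ z → z * p) (permSign-cong (σ ∘ₚ (π ∘ₚ τ)) (π[_] G F R α′ β′ φ) λ i → cong (Inverse.from β′)
             (trans (Inverse.strictlyInverseˡ β _)
                    (cong (apply φ) (Inverse.strictlyInverseˡ α (Inverse.to α′ i))))) ⟩
      permSign (π[_] G F R α′ β′ φ) * p
        ≡⟨ unnormalisedSign-reindex α α′ β′ φ ⟨
      unnormalisedSign G F R α′ β′ φ
        ∎
      where
      open ≡-Reasoning
      π = π[_] G F R α β φ
      p = product (entries α φ)
      regroup : ∀ a b c p → (a * b) * (c * p) ≡ a * (c * b) * p
      regroup = solve-∀

    -- Fitting orientations do not refer to any ordering, so Leibniz writes both determinants as
    -- sums over the same setoid, with summands that differ by `s`.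
    det-reorder : s * det (orderedMatrix G F R α β) ≡ det (orderedMatrix G F R α′ β′)
    det-reorder = sumOver-unique (FittingOrientations G F R) (unnormalisedSign G F R α′ β′)
      (λ {φ} {ψ} → unnormalisedSign-cong α′ β′ φ ψ)
      (sumOver-cong (FittingOrientations G F R)
        (λ φ → s * unnormalisedSign G F R α β φ) (unnormalisedSign G F R α′ β′)
        unnormalisedSign-reorder
        (sumOver-scale (FittingOrientations G F R) (unnormalisedSign G F R α β) s (sumOver-unnormalisedSign α β)))
      (sumOver-unnormalisedSign α′ β′)

    Λ-reorder : ∀ φ → Λ G F R α β φ ≡ Λ G F R α′ β′ φ
    Λ-reorder φ = begin
      o * u                    ≡⟨ ℤ.*-identityˡ (o * u) ⟨
      -- One copy of `s` is absorbed by the sign of the determinant, the other by the unnormalised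
      -- sign.
      1ℤ * (o * u)             ≡⟨ cong (λ z → z * (o * u)) (sign-square reordering-sign) ⟨
      (s * s) * (o * u)        ≡⟨ regroup s o u ⟩
      (s * o) * (s * u)        ≡⟨ cong₂ _*_
                                    (sym (signum-sign-* (det (orderedMatrix G F R α β)) reordering-sign))
                                    (unnormalisedSign-reorder φ) ⟩
      signum (s * det (orderedMatrix G F R α β)) * u′
                               ≡⟨ cong (λ z → signum z * u′) det-reorder ⟩
      Λ G F R α′ β′ φ          ∎
      where
      open ≡-Reasoning
      o = orderSign G F R α β
      u = unnormalisedSign G F R α β φ
      u′ = unnormalisedSign G F R α′ β′ φ
      regroup : ∀ s o u → (s * s) * (o * u) ≡ (s * o) * (s * u)
      regroup = solve-∀

proposition30 : ∀ {n d : ℕ} (G : SimplicialComplex n) → HasDimension G d →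
    (F : Sub (Face G (suc d))) (R : Sub (Face G d)) → IsRootedForest G F R →
    (∀ {m : ℕ} (α : Fin m ↔ El (R ᶜ)) (β : Fin m ↔ El F) →
    ∃[ h ] AbelianGroup.setoid (RelativeHomology G F R) HasCardinality h
    × SumOver (FittingOrientations G F R) (Λ G F R α β) (+ h))
    ×
    (∀ (φ : FittingOrientation G F R) {m : ℕ} (α α′ : Fin m ↔ El (R ᶜ)) (β β′ : Fin m ↔ El F) →
    (Λ G F R α β φ ≡ 1ℤ ⊎ Λ G F R α β φ ≡ -1ℤ) × Λ G F R α β φ ≡ Λ G F R α′ β′ φ)
proposition30 G _ F R rooted =
  (λ α β → ∣ det (orderedMatrix G F R α β) ∣ , homology-cardinality G F R α β rooted , sumOver-Λ G F R α β) ,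
  (λ φ α α′ β β′ → Λ-sign G F R α β rooted φ , Λ-reorder G F R α α′ β β′ φ)
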